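{- Let $k\in\mathbb{Z}^+$ with $k>1$ and $\pi\in S_k$. There exists a constant $C=C(\pi)$ such that for all integers $m,n\ge 0$ with $m\le\binom{n}{k}$, the number of permutations in $S_n$ containing at most $m$ copies of $\pi$ is at most \[\exp(Cn)\max\left(1,\left(\frac{m}{n}\right)^{\frac{n}{k-1}}\right).\] Furthermore, this bound is sharp to within an exponential factor: there is a constant $C'=C'(\pi)$ such that for all such $m,n$ the number of permutations in $S_n$ containing at most $m$ copies of $\pi$ is at least $\exp(C'n)\max\left(1,\left(\frac{m}{n}\right)^{\frac{n}{k-1}}\right)$.
   Context: A copy of $\pi\in S_k$ in $\sigma\in S_n$ is a set of indices $1\le x_1<\dots<x_k\le n$ such that for all $i,j$, $\pi(i)<\pi(j)\iff\sigma(x_i)<\sigma(x_j)$. -}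

module Defs where

open import Algebra.Definitions.RawSemiring using (_^_)
open import Data.Fin.Base as Fin using (Fin)
open import Data.Fin.Permutation using (Permutation′; _⟨$⟩ʳ_; _≈_; id; insert; remove; insert-remove)
open import Data.Fin.Properties using (all?; _<?_; punchIn-injective)
open import Data.Integer.Base using (+_)
open import Data.List.Base using (List; []; _∷_; [_]; allFin; cartesianProductWith; filter; length)
import Data.List.Membership.Propositional.Properties as ∈ₚ
import Data.List.Membership.Setoid as Membership
import Data.List.Membership.Setoid.Properties as ∈ₛ
open import Data.List.Relation.Unary.All using ([])
open import Data.List.Relation.Unary.AllPairs using ([]; _∷_)
open import Data.List.Relation.Unary.Any using (here)
import Data.List.Relation.Unary.Unique.Propositional.Properties as Uniqueₚ
import Data.List.Relation.Unary.Unique.Setoid as Unique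
import Data.List.Relation.Unary.Unique.Setoid.Properties as Uniqueₛ
open import Data.Nat.Base as ℕ using (ℕ; zero; suc)
import Data.Nat.Properties as ℕ
open import Data.Product.Base using (_×_; _,_; ∃-syntax)
open import Data.Rational.Unnormalised.Base as ℚ using (ℚᵘ; 0ℚᵘ; 1ℚᵘ; _/_; +-*-rawSemiring)
open import Data.Sum.Base using (_⊎_)
open import Data.Vec.Base using (Vec; []; _∷_; lookup)
open import Function.Bundles using (_⇔_; mk⇔; Equivalence)
open import Level using (0ℓ)
open import Relation.Binary.Bundles using (Setoid)
open import Relation.Binary.PropositionalEquality using (_≡_; refl; sym; trans; cong; setoid)
open import Relation.Nullary.Decidable using (Dec; map′; _×-dec_; _→-dec_)

------------------------------------------------------------------------
-- Copies of a pattern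

-- A set of k indices is given by its strictly increasing enumeration
-- x₁ < … < x_k.
record IsCopy {k n : ℕ} (π : Permutation′ k) (σ : Permutation′ n) (x : Vec (Fin n) k) : Set where
  constructor isCopy
  field
    increasing : ∀ i j → i Fin.< j → lookup x i Fin.< lookup x j
    pattern⇔   : ∀ i j → ((π ⟨$⟩ʳ i) Fin.< (π ⟨$⟩ʳ j)) ⇔
                         ((σ ⟨$⟩ʳ lookup x i) Fin.< (σ ⟨$⟩ʳ lookup x j))

isCopy? : ∀ {k n} (π : Permutation′ k) (σ : Permutation′ n) (x : Vec (Fin n) k) → Dec (IsCopy π σ x)
isCopy? π σ x = map′ (λ (inc , pat) → isCopy inc pat) (λ (isCopy inc pat) → inc , pat)
  (all? (λ i → all? λ j → (i <? j) →-dec (lookup x i <? lookup x j)) ×-dec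
   all? (λ i → all? λ j → ((π ⟨$⟩ʳ i) <? (π ⟨$⟩ʳ j)) ⇔? ((σ ⟨$⟩ʳ lookup x i) <? (σ ⟨$⟩ʳ lookup x j))))
  where
  _⇔?_ : ∀ {A B : Set} → Dec A → Dec B → Dec (A ⇔ B)
  a? ⇔? b? = map′ (λ (f , g) → mk⇔ f g) (λ e → Equivalence.to e , Equivalence.from e)
    ((a? →-dec b?) ×-dec (b? →-dec a?))

tuples : (n k : ℕ) → List (Vec (Fin n) k)
tuples n zero    = [ [] ]
tuples n (suc k) = cartesianProductWith _∷_ (allFin n) (tuples n k)

#copies : ∀ {k n} → Permutation′ k → Permutation′ n → ℕ
#copies {k} {n} π σ = length (filter (isCopy? π σ) (tuples n k))

------------------------------------------------------------------------
-- The symmetric group, enumerated without repetition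

permutations : (n : ℕ) → List (Permutation′ n)
permutations zero    = [ id ]
permutations (suc n) = cartesianProductWith (insert Fin.zero) (allFin (suc n)) (permutations n)

#permutationsWithAtMost : ℕ → ∀ {k} → Permutation′ k → ℕ → ℕ
#permutationsWithAtMost m π n = length (filter (λ σ → #copies π σ ℕ.≤? m) (permutations n))

permutationSetoid : ℕ → Setoid 0ℓ 0ℓ
permutationSetoid n = record
  { Carrier = Permutation′ n
  ; _≈_ = _≈_
  ; isEquivalence = record
    { refl  = λ _ → refl
    ; sym   = λ p i → sym (p i)
    ; trans = λ p q i → trans (p i) (q i)
    }
  }

private
  insert-cong : ∀ {n} {i j : Fin (suc n)} {π ρ : Permutation′ n} → i ≡ j → π ≈ ρ →
                insert Fin.zero i π ≈ insert Fin.zero j ρ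
  insert-cong refl p Fin.zero    = refl
  insert-cong {i = i} refl p (Fin.suc x) = cong (Fin.punchIn i) (p x)

  insert-injective : ∀ {n} {i j : Fin (suc n)} {π ρ : Permutation′ n} →
                     insert Fin.zero i π ≈ insert Fin.zero j ρ → i ≡ j × π ≈ ρ
  insert-injective {i = i} {π = π} {ρ} p with p Fin.zero
  ... | refl = refl , λ x → punchIn-injective i (π ⟨$⟩ʳ x) (ρ ⟨$⟩ʳ x) (p (Fin.suc x))

permutations-complete : ∀ n (σ : Permutation′ n) → Membership._∈_ (permutationSetoid n) σ (permutations n)
permutations-complete zero    σ = here λ ()
permutations-complete (suc n) σ = ∈ₛ.∈-resp-≈ (permutationSetoid (suc n))
  {x = insert Fin.zero (σ ⟨$⟩ʳ Fin.zero) (remove Fin.zero σ)} {y = σ} (insert-remove Fin.zero σ)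
  (∈ₛ.∈-cartesianProductWith⁺ (setoid _) (permutationSetoid n) (permutationSetoid (suc n))
    (λ {_} {_} {π} {ρ} → insert-cong {π = π} {ρ})
    (∈ₚ.∈-allFin (σ ⟨$⟩ʳ Fin.zero)) (permutations-complete n (remove Fin.zero σ)))

permutations-unique : ∀ n → Unique.Unique (permutationSetoid n) (permutations n)
permutations-unique zero    = [] ∷ []
permutations-unique (suc n) = Uniqueₛ.cartesianProductWith⁺
  (setoid _) (permutationSetoid n) (permutationSetoid (suc n)) (insert Fin.zero)
  (λ {_} {_} {π} {ρ} → insert-injective {π = π} {ρ})
  (Uniqueₚ.allFin⁺ (suc n)) (permutations-unique n)

------------------------------------------------------------------------
-- Nonnegative real numbers as Dedekind cuts

-- x : ℝ⁺ stands for the nonnegative real whose rational strict lower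
-- bounds are the q with x q.
ℝ⁺ : Set₁
ℝ⁺ = ℚᵘ → Set

infix 4 _≼_
_≼_ : ℝ⁺ → ℝ⁺ → Set
x ≼ y = ∀ q → x q → y q

fromℕ : ℕ → ℝ⁺
fromℕ n q = q ℚ.< + n / 1

max : ℝ⁺ → ℝ⁺ → ℝ⁺
max x y q = x q ⊎ y q

infixl 7 _·_
_·_ : ℝ⁺ → ℝ⁺ → ℝ⁺
(x · y) q = q ℚ.< 0ℚᵘ ⊎
  ∃[ s ] ∃[ t ] (0ℚᵘ ℚ.≤ s) × x s × (0ℚᵘ ℚ.≤ t) × y t × q ℚ.≤ s ℚ.* t

infixr 8 _^ℕ_
_^ℕ_ : ℚᵘ → ℕ → ℚᵘ
_^ℕ_ = _^_ +-*-rawSemiring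

-- b ^[ p / r ] is the real power with exponent p/r, for b ≥ 0 and r ≥ 1
-- (so 0 ^[ 0 / r ] is 1): a rational q ≥ 0 is below it iff qʳ < bᵖ.
infixr 8 _^[_/_]
_^[_/_] : ℚᵘ → ℕ → ℕ → ℝ⁺
(b ^[ p / r ]) q = q ℚ.< 0ℚᵘ ⊎ q ^ℕ r ℚ.< b ^ℕ p

-- The limit of a convergent sequence of rationals with nonnegative limit.
lim : (ℕ → ℚᵘ) → ℝ⁺
lim s q = ∃[ q′ ] q ℚ.< q′ × ∃[ J ] (∀ j → J ℕ.≤ j → q′ ℚ.≤ s j)

-- exp c = lim (1 + c/j)ʲ; the index is shifted to avoid j = 0.
-- Rational c suffice: a bound exp (c n) · B, from above or from below, with
-- a real constant c still holds after rounding c up, respectively down.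
exp : ℚᵘ → ℝ⁺
exp c = lim λ j → (1ℚᵘ ℚ.+ c ℚ.* (+ 1 / suc j)) ^ℕ suc j

-- Only the base m/n of a power with exponent n/(k-1) uses this, so that
-- at n = 0 the value of the quotient is irrelevant.
infixl 7 _/₀_
_/₀_ : ℕ → ℕ → ℚᵘ
m /₀ zero    = 0ℚᵘ
m /₀ n@(suc _) = + m / n

-- Upper bound: let b be least with m ≤ n bᵏ⁻¹. Averaging over the colourings
-- of the positions by b colours gives one for which half of the permutations
-- counted have at most 2n monochromatic copies of π. Such a permutation is
-- determined by the colours of its values (bⁿ choices) and by its restrictions
-- to the colour classes, and O(n) bits suffice for the latter. Indeed a 0-1
-- matrix of side a with ℓ copies of π has O(a + ℓ) ones (Marcus–Tardos, then
-- delete one entry per copy), hence O(d a + ℓ/d) ones for every d, by splitting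
-- its columns into d classes that destroy most copies. Contracting the matrix
-- repeatedly, as in Klazar's argument, and letting d grow geometrically, the
-- costs of the levels sum to O(a + ℓ).
--
-- Lower bound: if n tᵏ⁻¹ ≤ m, take direct sums of arbitrary blocks of size
-- t + 1, or their reversals. If π descends from its first to its last entry,
-- a copy of π in a direct sum stays in one block, so there are at most n tᵏ⁻¹.

module Submission where

open import Data.Bool.Base using (Bool; true; false; T; _∧_; _∨_; not; if_then_else_)
open import Data.Bool.ListAction using (any)
open import Data.Bool.Properties using (T?; T-∧; T-∨)
open import Data.Fin.Base as Fin using (Fin; zero; suc; toℕ; fromℕ<; opposite; punchIn; combine; quotient; _↑ˡ_; _↑ʳ_)
open import Data.Fin.Permutation using (Permutation′; _⟨$⟩ʳ_; _⟨$⟩ˡ_; _≈_; id; flip; inverseˡ; insert; reverse; _∘ₚ_)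
open import Data.Fin.Properties using (all?; any?; _≟_; _<?_; toℕ-injective; toℕ-fromℕ<; toℕ-fromℕ; toℕ≤pred[n]; toℕ-↑ˡ; ↑ˡ-injective; toℕ-combine; combine-monoˡ-<; combine-surjective; remQuot-combine; punchIn-injective; punchIn-cancel-≤; opposite-involutive; opposite-prop)
import Data.Fin.Properties as Fin
import Data.Integer.Base as ℤ
import Data.Integer.Properties as ℤ
open import Data.Integer.Tactic.RingSolver using () renaming (solve-∀ to ℤ-solve-∀)
open import Data.List.Base using (List; []; _∷_; [_]; _++_; length; map; filter; concatMap; allFin; cartesianProduct; cartesianProductWith)
open import Data.List.Membership.Propositional using (_∈_)
open import Data.List.Membership.Propositional.Properties using (∈-allFin; ∈-filter⁺; ∈-map⁻; ∈-cartesianProduct⁺; ∈-cartesianProductWith⁺)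
open import Data.List.Properties using (length-++; length-map; length-tabulate; ++-assoc; ∷-injective)
open import Data.List.Relation.Unary.All using (All; []; _∷_)
import Data.List.Relation.Unary.All as All
import Data.List.Relation.Unary.All.Properties as All
open import Data.List.Relation.Unary.AllPairs using (AllPairs; []; _∷_)
import Data.List.Relation.Unary.AllPairs.Properties as AllPairs
open import Data.List.Relation.Unary.Any using (Any; here; there)
import Data.List.Relation.Unary.Any as Any
import Data.List.Relation.Unary.Any.Properties as Any
open import Data.List.Relation.Unary.Unique.Propositional using (Unique)
import Data.List.Relation.Unary.Unique.Propositional.Properties as Unique
import Data.List.Relation.Unary.Unique.Setoid as Uniqueₛ
import Data.List.Relation.Unary.Unique.Setoid.Properties as Uniqueₛ
open import Data.Nat.Base as ℕ hiding (_/_; _%_)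
open import Data.Nat.Combinatorics using (_C_; nCk+nC[k+1]≡[n+1]C[k+1]; nCk≡nC[n∸k]; nCn≡1; k>n⇒nCk≡0)
open import Data.Nat.DivMod using (_mod_; m≡m%n+[m/n]*n; m%n<n; m<n⇒m%n≡m)
import Data.Nat.ListAction as List
open import Data.Nat.Properties hiding (_≟_; _<?_)
open import Data.Nat.Tactic.RingSolver using (solve-∀)
open import Data.Product.Base using (_×_; _,_; ∃-syntax; Σ-syntax; proj₁; proj₂)
open import Data.Rational.Unnormalised.Base as ℚ using (ℚᵘ; mkℚᵘ; _/_; *≡*; *≤*; *<*; 0ℚᵘ; 1ℚᵘ)
import Data.Rational.Unnormalised.Properties as ℚ
open import Data.Sum.Base as Sum using (_⊎_; inj₁; inj₂)
open import Data.Vec.Base using (Vec; []; _∷_; lookup; tabulate)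
import Data.Vec.Properties as Vec
open import Data.Vec.Properties using (lookup∘tabulate; tabulate∘lookup; tabulate-cong)
open import Function.Base using (_∘_)
open import Function.Bundles using (Equivalence; Injection; mk⇔)
open import Function.Properties.Inverse using (↔⇒↣)
open import Relation.Binary.Definitions using (tri<; tri≈; tri>)
open import Relation.Binary.PropositionalEquality using (_≡_; _≗_; refl; sym; trans; cong; cong₂; subst; subst₂; setoid; module ≡-Reasoning)
open import Relation.Nullary using (¬_; Dec; yes; no; contradiction)
open import Relation.Nullary.Decidable using (⌊_⌋; toWitness; fromWitness; _×-dec_; _→-dec_)
open import Relation.Unary using (Decidable)

open import Algebra.Properties.Semiring.Sum +-*-semiring
  using (sum; sum-syntax; sum-cong-≗; ∑-distrib-+; ∑-comm; *-distribˡ-sum; *-distribʳ-sum; sum-permute)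

open import Defs


-- A single integer `t` with n t^(k-1) ≤ m < n (t + 1)^(k-1) governs both bounds: it gives t + 1
-- colours above and blocks of size t + 1 below, and m ≤ C(n, k) forces t ≤ n, which keeps all error
-- exponents linear in n. The obstacle in the upper bound is that a contraction divides the side of
-- a matrix by a constant but need not reduce the number of copies. With the bound O(a + ℓ) alone, ℓ
-- would be paid at each of logarithmically many levels; the variant with d trades surplus decay of
-- the sides for geometric decay of the ℓ terms. Copies are tracked by a list containing every
-- occurrence, not by their exact number, since such a list passes through contractions by `map` and
-- through column splittings by `filter`. Real powers stay out of the combinatorics: exponential
-- factors are powers of 2, inequalities are raised to the power k - 1 and cleared of denominators,
-- and only the end compares 2^(γ n) with `exp`.

-- Finite sums and counting

∑-mono : ∀ {n} {f g : Fin n → ℕ} → (∀ i → f i ≤ g i) → sum f ≤ sum g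
∑-mono {zero}  f≤g = z≤n
∑-mono {suc n} f≤g = +-mono-≤ (f≤g zero) (∑-mono (f≤g ∘ suc))

∑-const : ∀ n c → ∑[ _ < n ] c ≡ n * c
∑-const zero    c = refl
∑-const (suc n) c = cong (c +_) (∑-const n c)

∑-bounded : ∀ {n} {f : Fin n → ℕ} c → (∀ i → f i ≤ c) → sum f ≤ n * c
∑-bounded {n} c f≤c = ≤-trans (∑-mono f≤c) (≤-reflexive (∑-const n c))

∑-term : ∀ {n} (f : Fin n → ℕ) i → f i ≤ sum f
∑-term f zero    = m≤m+n _ _
∑-term f (suc i) = ≤-trans (∑-term (f ∘ suc) i) (m≤n+m _ _)

∑-++ : ∀ m {n} (f : Fin (m + n) → ℕ) →
       sum f ≡ ∑[ i < m ] f (i ↑ˡ n) + ∑[ j < n ] f (m ↑ʳ j)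
∑-++ zero    f = refl
∑-++ (suc m) f = trans (cong (f zero +_) (∑-++ m (f ∘ suc))) (sym (+-assoc (f zero) _ _))

∑-combine : ∀ m {n} (f : Fin (m * n) → ℕ) → sum f ≡ ∑[ i < m ] ∑[ j < n ] f (combine i j)
∑-combine zero        f = refl
∑-combine (suc m) {n} f = trans (∑-++ n f) (cong (sum (λ j → f (j ↑ˡ m * n)) +_) (∑-combine m (f ∘ (n ↑ʳ_))))

⟦_⟧ : Bool → ℕ
⟦ true  ⟧ = 1
⟦ false ⟧ = 0

⟦⟧-mono : ∀ {a b} → (T a → T b) → ⟦ a ⟧ ≤ ⟦ b ⟧
⟦⟧-mono {false}         f = z≤n
⟦⟧-mono {true}  {true}  f = ≤-refl
⟦⟧-mono {true}  {false} f with () ← f _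

⟦⟧≤1 : ∀ b → ⟦ b ⟧ ≤ 1
⟦⟧≤1 true  = ≤-refl
⟦⟧≤1 false = z≤n

⟦⟧-∨ : ∀ a b → ⟦ a ∨ b ⟧ ≤ ⟦ a ⟧ + ⟦ b ⟧
⟦⟧-∨ true  b = m≤m+n 1 _
⟦⟧-∨ false b = ≤-refl

⟦⟧-≤ : ∀ {b} {x} → (T b → 1 ≤ x) → ⟦ b ⟧ ≤ x
⟦⟧-≤ {true}  f = f _
⟦⟧-≤ {false} f = z≤n

T⇒1≤⟦⟧ : ∀ {b} → T b → 1 ≤ ⟦ b ⟧
T⇒1≤⟦⟧ {true} _ = ≤-refl

T-∧⁺ : ∀ {a b} → T a → T b → T (a ∧ b)
T-∧⁺ p q = Equivalence.from T-∧ (p , q)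

T-∧⁻ : ∀ {a b} → T (a ∧ b) → T a × T b
T-∧⁻ = Equivalence.to T-∧

count : ∀ {n} → (Fin n → Bool) → ℕ
count p = sum (⟦_⟧ ∘ p)

count≤n : ∀ {n} (p : Fin n → Bool) → count p ≤ n
count≤n {n} p = ≤-trans (∑-bounded 1 (⟦⟧≤1 ∘ p)) (≤-reflexive (*-identityʳ n))

some : ∀ {n} → (Fin n → Bool) → Bool
some {zero}  p = false
some {suc n} p = p zero ∨ some (p ∘ suc)

some⁺ : ∀ {n} (p : Fin n → Bool) i → T (p i) → T (some p)
some⁺ p zero    h = Equivalence.from T-∨ (inj₁ h)
some⁺ p (suc i) h = Equivalence.from (T-∨ {p zero}) (inj₂ (some⁺ (p ∘ suc) i h))

some⁻ : ∀ {n} (p : Fin n → Bool) → T (some p) → ∃[ i ] T (p i)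
some⁻ {suc n} p h with Equivalence.to (T-∨ {p zero}) h
... | inj₁ h₀ = zero , h₀
... | inj₂ h₁ with i , hᵢ ← some⁻ (p ∘ suc) h₁ = suc i , hᵢ

Increasing : ∀ {k n} → (Fin k → Fin n) → Set
Increasing x = ∀ i j → i Fin.< j → x i Fin.< x j

cons-zero : ∀ {k n} → (Fin k → Fin n) → Fin (suc k) → Fin (suc n)
cons-zero x zero    = zero
cons-zero x (suc i) = suc (x i)

select : ∀ {n} (p : Fin n → Bool) k → k ≤ count p →
         ∃[ x ] Increasing {k} {n} x × (∀ i → T (p (x i)))
select         p zero    k≤ = (λ ()) , (λ ()) , λ ()
select {suc n} p (suc k) k≤ with p zero in eq
... | true with x , inc , px ← select (p ∘ suc) k (s≤s⁻¹ k≤) = cons-zero x , inc′ , px′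
  where
  inc′ : Increasing (cons-zero x)
  inc′ zero    (suc j) _       = z<s
  inc′ (suc i) (suc j) (s<s l) = s<s (inc i j l)
  px′ : ∀ i → T (p (cons-zero x i))
  px′ zero    = subst T (sym eq) _
  px′ (suc i) = px i
... | false with x , inc , px ← select (p ∘ suc) (suc k) k≤ =
  suc ∘ x , (λ i j l → s<s (inc i j l)) , px

-- Union bound over the list; in `count-wide` it serves as the pigeonhole principle over all tuples
-- of columns.
count-any : ∀ {n} {A : Set} (R : Fin n → A → Bool) c →
            (∀ t → count (λ i → R i t) ≤ c) → ∀ ts → count (λ i → any (R i) ts) ≤ length ts * c
count-any {n} R c h []       = ≤-trans (∑-bounded {n} 0 (λ _ → z≤n)) (≤-reflexive (*-zeroʳ n))
count-any {n} R c h (t ∷ ts) = begin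
  count (λ i → R i t ∨ any (R i) ts)              ≤⟨ ∑-mono (λ i → ⟦⟧-∨ (R i t) _) ⟩
  ∑[ i < n ] (⟦ R i t ⟧ + ⟦ any (R i) ts ⟧)         ≡⟨ ∑-distrib-+ (λ i → ⟦ R i t ⟧) _ ⟩
  count (λ i → R i t) + count (λ i → any (R i) ts) ≤⟨ +-mono-≤ (h t) (count-any R c h ts) ⟩
  c + length ts * c ∎
  where open ≤-Reasoning

-- 0-1 matrices

Matrix : ℕ → Set
Matrix a = Fin a → Fin a → Bool

ones : ∀ {a} → Matrix a → ℕ
ones {a} M = ∑[ x < a ] count (M x)

_ᵀ : ∀ {a} → Matrix a → Matrix a
(M ᵀ) x y = M y x

occupied : ∀ {a} → Matrix a → Fin a → Bool
occupied M x = some (M x)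

ones-≤-area : ∀ {a} (M : Matrix a) → ones M ≤ a * a
ones-≤-area M = ∑-bounded _ (count≤n ∘ M)

ones-≤-occupied : ∀ {a} (M : Matrix a) → ones M ≤ count (occupied M) * count (occupied (M ᵀ))
ones-≤-occupied {a} M = begin
  ones M                                                       ≤⟨ ∑-mono (λ x → ∑-mono (λ y → entry x y)) ⟩
  ∑[ x < a ] ∑[ y < a ] (⟦ occupied M x ⟧ * ⟦ occupied (M ᵀ) y ⟧) ≡⟨ sum-cong-≗ (λ x → sym (*-distribˡ-sum ⟦ occupied M x ⟧ (⟦_⟧ ∘ occupied (M ᵀ)))) ⟩
  ∑[ x < a ] (⟦ occupied M x ⟧ * count (occupied (M ᵀ)))          ≡⟨ sym (*-distribʳ-sum (count (occupied (M ᵀ))) (⟦_⟧ ∘ occupied M)) ⟩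
  count (occupied M) * count (occupied (M ᵀ)) ∎
  where
  open ≤-Reasoning
  entry : ∀ x y → ⟦ M x y ⟧ ≤ ⟦ occupied M x ⟧ * ⟦ occupied (M ᵀ) y ⟧
  entry x y = ⟦⟧-≤ λ h → *-mono-≤ {1} {⟦ occupied M x ⟧} (T⇒1≤⟦⟧ (some⁺ (M x) y h)) (T⇒1≤⟦⟧ (some⁺ ((M ᵀ) y) x h))

module _ (q s : ℕ) where

  block : Matrix (q * s) → Fin q → Fin q → Matrix s
  block M X Y x y = M (combine X x) (combine Y y)

  contract : Matrix (q * s) → Matrix q
  contract M X Y = some (occupied (block M X Y))

  contract⁻ : ∀ M X Y → T (contract M X Y) → ∃[ x ] ∃[ y ] T (block M X Y x y)
  contract⁻ M X Y h with x , hx ← some⁻ (occupied (block M X Y)) h with y , hy ← some⁻ (block M X Y x) hx = x , y , hy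

  contract⁺ : ∀ M X Y x y → T (block M X Y x y) → T (contract M X Y)
  contract⁺ M X Y x y h = some⁺ (occupied (block M X Y)) x (some⁺ (block M X Y x) y h)

  ones-blocks : ∀ M → ones M ≡ ∑[ X < q ] ∑[ Y < q ] ones (block M X Y)
  ones-blocks M = trans (∑-combine q (count ∘ M)) (sum-cong-≗ λ X →
    trans (sum-cong-≗ λ x → ∑-combine q (⟦_⟧ ∘ M (combine X x)))
          (∑-comm λ x Y → count (block M X Y x)))

∈-tuples : ∀ {n k} (x : Vec (Fin n) k) → x ∈ tuples n k
∈-tuples []      = here refl
∈-tuples (i ∷ x) = ∈-cartesianProductWith⁺ _∷_ (∈-allFin i) (∈-tuples x)

length-cartesianProductWith : ∀ {A B C : Set} (f : A → B → C) xs ys →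
                              length (cartesianProductWith f xs ys) ≡ length xs * length ys
length-cartesianProductWith f []       ys = refl
length-cartesianProductWith f (x ∷ xs) ys = trans (length-++ (map (f x) ys))
  (cong₂ _+_ (length-map (f x) ys) (length-cartesianProductWith f xs ys))

length-tuples : ∀ n k → length (tuples n k) ≡ n ^ k
length-tuples n zero    = refl
length-tuples n (suc k) = trans (length-cartesianProductWith _∷_ (allFin n) (tuples n k))
  (cong₂ _*_ (length-tabulate {n = n} (λ i → i)) (length-tuples n k))

-- Pattern avoidance and the Marcus-Tardos bound

abstract
  increasing? : ∀ {k n} (x : Fin k → Fin n) → Dec (Increasing x)
  increasing? x = all? λ i → all? λ j → (i <? j) →-dec (x i <? x j)

-- Rows and columns of an occurrence are both indexed by the position in π,
-- so only the columns increase; the rows are ordered as the values of π.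
record Occurrence {k a} (π : Permutation′ k) (M : Matrix a) (x y : Fin k → Fin a) : Set where
  constructor occurrence
  field
    increasing : Increasing x
    ordered    : ∀ i j → (π ⟨$⟩ʳ i) Fin.< (π ⟨$⟩ʳ j) → y i Fin.< y j
    marked     : ∀ i → T (M (x i) (y i))

Avoids : ∀ {k a} → Permutation′ k → Matrix a → Set
Avoids π M = ∀ {x y} → ¬ Occurrence π M x y

avoids-ᵀ : ∀ {k a} (π : Permutation′ k) (M : Matrix a) → Avoids π M → Avoids (flip π) (M ᵀ)
avoids-ᵀ π M avoids {x} {y} (occurrence inc ord mk) = avoids {y ∘ (π ⟨$⟩ʳ_)} {x ∘ (π ⟨$⟩ʳ_)} (occurrence
  (λ i j i<j → ord _ _ (subst₂ Fin._<_ (sym (inverseˡ π)) (sym (inverseˡ π)) i<j))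
  (λ i j → inc _ _)
  (λ i → mk _))

-- The wide blocks of Marcus and Tardos for a pattern of length r + 1. Their tall blocks are the
-- blocks with wide transpose.
wide : ∀ {s} → ℕ → Matrix s → Bool
wide r B = r <ᵇ count (occupied B)

¬wide : ∀ {s} r (B : Matrix s) → ¬ T (wide r B) → count (occupied B) ≤ r
¬wide r B h = ≮⇒≥ λ m<n → h (<⇒<ᵇ m<n)

-- A block that is neither wide nor tall has its ones within r columns and r rows, so at most r² of
-- them. A wide or tall block is charged its whole area, as such blocks are rare.
ones-block : ∀ {s} r (B : Matrix s) →
             ones B ≤ r * r * ⟦ some (occupied B) ⟧ + s * s * (⟦ wide r B ⟧ + ⟦ wide r (B ᵀ) ⟧)
ones-block {s} r B with T? (wide r B) | T? (wide r (B ᵀ))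
... | yes w | _ = begin
  ones B                       ≤⟨ ones-≤-area B ⟩
  s * s                        ≡⟨ sym (*-identityʳ (s * s)) ⟩
  s * s * 1                    ≤⟨ *-monoʳ-≤ (s * s) (≤-trans (T⇒1≤⟦⟧ w) (m≤m+n _ _)) ⟩
  s * s * (⟦ wide r B ⟧ + ⟦ wide r (B ᵀ) ⟧) ≤⟨ m≤n+m _ _ ⟩
  _ ∎
  where open ≤-Reasoning
... | no _ | yes w = begin
  ones B                       ≤⟨ ones-≤-area B ⟩
  s * s                        ≡⟨ sym (*-identityʳ (s * s)) ⟩
  s * s * 1                    ≤⟨ *-monoʳ-≤ (s * s) (≤-trans (T⇒1≤⟦⟧ w) (m≤n+m _ _)) ⟩
  s * s * (⟦ wide r B ⟧ + ⟦ wide r (B ᵀ) ⟧) ≤⟨ m≤n+m _ _ ⟩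
  _ ∎
  where open ≤-Reasoning
... | no ¬w | no ¬w′ with T? (some (occupied B))
...   | yes h = begin
  ones B                                     ≤⟨ ones-≤-occupied B ⟩
  count (occupied B) * count (occupied (B ᵀ)) ≤⟨ *-mono-≤ (¬wide r B ¬w) (¬wide r (B ᵀ) ¬w′) ⟩
  r * r                                      ≡⟨ sym (*-identityʳ (r * r)) ⟩
  r * r * 1                                  ≤⟨ *-monoʳ-≤ (r * r) (T⇒1≤⟦⟧ h) ⟩
  r * r * ⟦ some (occupied B) ⟧              ≤⟨ m≤m+n _ _ ⟩
  _ ∎
  where open ≤-Reasoning
...   | no ¬h = begin
  ones B          ≤⟨ ∑-bounded _ (λ x → ∑-bounded {s} 0 (λ y → ⟦⟧-≤ (λ h → contradiction (some⁺ (occupied B) x (some⁺ (B x) y h)) ¬h))) ⟩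
  s * (s * 0)     ≡⟨ trans (cong (s *_) (*-zeroʳ s)) (*-zeroʳ s) ⟩
  0               ≤⟨ z≤n ⟩
  _ ∎
  where open ≤-Reasoning

module _ {r : ℕ} (π : Permutation′ (suc r)) (q s : ℕ) where

  -- Any choice of one entry from each block works: the entries of an occurrence lie in distinct
  -- block rows and block columns, so the order of the blocks alone decides the order of the
  -- entries.
  lift : ∀ (M : Matrix (q * s)) {X Y} → Occurrence π (contract q s M) X Y →
         Σ[ a ∈ (Fin (suc r) → Fin s) ] Σ[ b ∈ (Fin (suc r) → Fin s) ] Occurrence π M (λ i → combine (X i) (a i)) (λ i → combine (Y i) (b i))
  lift M {X} {Y} (occurrence inc ord mk) = (λ i → proj₁ (point i)) , (λ i → proj₁ (proj₂ (point i))) , occurrence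
    (λ i j i<j → combine-monoˡ-< _ _ (inc i j i<j))
    (λ i j lt → combine-monoˡ-< _ _ (ord i j lt))
    (λ i → proj₂ (proj₂ (point i)))
    where
    point : ∀ i → ∃[ x ] ∃[ y ] T (block q s M (X i) (Y i) x y)
    point i = contract⁻ q s M (X i) (Y i) (mk i)

  contract-avoids : ∀ (M : Matrix (q * s)) → Avoids π M → Avoids π (contract q s M)
  contract-avoids M avoids occ with _ , _ , occ′ ← lift M occ = avoids occ′

  -- A wide block meets r + 1 common columns; by pigeonhole, too many wide
  -- blocks in one block column would share these, and so form every pattern.
  count-wide : ∀ (M : Matrix (q * s)) → Avoids π M → ∀ X →
               count (λ Y → wide r (block q s M X Y)) ≤ s ^ suc r * r
  count-wide M avoids X = begin
    count (λ Y → wide r (block q s M X Y))        ≤⟨ ∑-mono (λ Y → ⟦⟧-mono (covered Y)) ⟩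
    count (λ Y → any (crosses Y) (tuples s (suc r))) ≤⟨ count-any crosses r few (tuples s (suc r)) ⟩
    length (tuples s (suc r)) * r                 ≡⟨ cong (_* r) (length-tuples s (suc r)) ⟩
    s ^ suc r * r ∎
    where
    open ≤-Reasoning
    Crosses? : ∀ Y (t : Vec (Fin s) (suc r)) → Dec (Increasing (lookup t) × (∀ i → T (occupied (block q s M X Y) (lookup t i))))
    Crosses? Y t = increasing? (lookup t) ×-dec all? (λ i → T? (occupied (block q s M X Y) (lookup t i)))

    crosses : Fin q → Vec (Fin s) (suc r) → Bool
    crosses Y t = ⌊ Crosses? Y t ⌋

    covered : ∀ Y → T (wide r (block q s M X Y)) → T (any (crosses Y) (tuples s (suc r)))
    covered Y w with t , inc , occ ← select (occupied (block q s M X Y)) (suc r) (<ᵇ⇒< r _ w) =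
      Any.any⁺ (crosses Y) (Any.map (λ { refl → fromWitness {a? = Crosses? Y (tabulate t)}
        ( (λ i j i<j → subst₂ Fin._<_ (sym (lookup∘tabulate t i)) (sym (lookup∘tabulate t j)) (inc i j i<j))
        , (λ i → subst (T ∘ occupied (block q s M X Y)) (sym (lookup∘tabulate t i)) (occ i))) })
        (∈-tuples (tabulate t)))

    few : ∀ t → count (λ Y → crosses Y t) ≤ r
    few t = ≮⇒≥ λ r<c → many (select (λ Y → crosses Y t) (suc r) r<c)
      where
      many : ¬ (∃[ Y ] Increasing {suc r} Y × (∀ i → T (crosses (Y i) t)))
      many (Y , inc , cr) = avoids {λ i → combine X (lookup t i)} {λ i → combine (Y (π ⟨$⟩ʳ i)) (proj₁ (row i))}
        (occurrence
          (λ i j i<j → combine-monoʳ-< X (proj₁ (toWitness {a? = Crosses? (Y zero) t} (cr zero)) i j i<j))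
          (λ i j lt → combine-monoˡ-< _ _ (inc _ _ lt))
          (λ i → proj₂ (row i)))
        where
        combine-monoʳ-< : ∀ (X : Fin q) {x x′ : Fin s} → x Fin.< x′ → combine X x Fin.< combine X x′
        combine-monoʳ-< X {x} {x′} lt = subst₂ _<_ (sym (toℕ-combine X x)) (sym (toℕ-combine X x′)) (+-monoʳ-< (s * toℕ X) lt)
        row : ∀ i → ∃[ y ] T (block q s M X (Y (π ⟨$⟩ʳ i)) (lookup t i) y)
        row i = some⁻ _ (proj₂ (toWitness {a? = Crosses? (Y (π ⟨$⟩ʳ i)) t} (cr (π ⟨$⟩ʳ i))) i)

module _ {r : ℕ} (π : Permutation′ (suc r)) (q s : ℕ) where

  -- Sums `ones-block` over all blocks. Wide blocks are counted by block columns, and tall ones by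
  -- block rows through the transpose, which avoids the inverse pattern; this is the factor 2.
  ones-contract : ∀ (M : Matrix (q * s)) → Avoids π M →
    ones M ≤ r * r * ones (contract q s M) + s * s * (2 * (q * (s ^ suc r * r)))
  ones-contract M avoids = begin
    ones M                                     ≡⟨ ones-blocks q s M ⟩
    ∑[ X < q ] ∑[ Y < q ] ones (B X Y)         ≤⟨ ∑-mono (λ X → ∑-mono (λ Y → ones-block r (B X Y))) ⟩
    ∑[ X < q ] ∑[ Y < q ] (r * r * ⟦ contract q s M X Y ⟧ + s * s * (⟦ W X Y ⟧ + ⟦ W′ X Y ⟧))
      ≡⟨ pull (λ X Y → ⟦ contract q s M X Y ⟧) (λ X Y → ⟦ W X Y ⟧ + ⟦ W′ X Y ⟧) (r * r) (s * s) ⟩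
    r * r * ones (contract q s M) + s * s * (∑[ X < q ] ∑[ Y < q ] (⟦ W X Y ⟧ + ⟦ W′ X Y ⟧))
      ≤⟨ +-monoʳ-≤ _ (*-monoʳ-≤ (s * s) wides) ⟩
    r * r * ones (contract q s M) + s * s * (2 * (q * (s ^ suc r * r))) ∎
    where
    open ≤-Reasoning
    B = block q s M
    W W′ : Fin q → Fin q → Bool
    W  X Y = wide r (B X Y)
    W′ X Y = wide r (B X Y ᵀ)

    pull : ∀ (f g : Fin q → Fin q → ℕ) a b →
           ∑[ X < q ] ∑[ Y < q ] (a * f X Y + b * g X Y)
           ≡ a * (∑[ X < q ] ∑[ Y < q ] f X Y) + b * (∑[ X < q ] ∑[ Y < q ] g X Y)
    pull f g a b = trans
      (sum-cong-≗ λ X → trans (∑-distrib-+ (λ Y → a * f X Y) (λ Y → b * g X Y))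
        (cong₂ _+_ (sym (*-distribˡ-sum a (f X))) (sym (*-distribˡ-sum b (g X)))))
      (trans (∑-distrib-+ (λ X → a * sum (f X)) (λ X → b * sum (g X)))
        (cong₂ _+_ (sym (*-distribˡ-sum a (sum ∘ f))) (sym (*-distribˡ-sum b (sum ∘ g)))))

    wides : ∑[ X < q ] ∑[ Y < q ] (⟦ W X Y ⟧ + ⟦ W′ X Y ⟧) ≤ 2 * (q * (s ^ suc r * r))
    wides = begin
      ∑[ X < q ] ∑[ Y < q ] (⟦ W X Y ⟧ + ⟦ W′ X Y ⟧)
        ≡⟨ sum-cong-≗ (λ X → ∑-distrib-+ (⟦_⟧ ∘ W X) (⟦_⟧ ∘ W′ X)) ⟩
      ∑[ X < q ] (count (W X) + count (W′ X))
        ≡⟨ ∑-distrib-+ (count ∘ W) (count ∘ W′) ⟩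
      ∑[ X < q ] count (W X) + ∑[ X < q ] count (W′ X)
        ≡⟨ cong (∑[ X < q ] count (W X) +_) (∑-comm (λ X Y → ⟦ W′ X Y ⟧)) ⟩
      ∑[ X < q ] count (W X) + ∑[ Y < q ] count (λ X → W′ X Y)
        ≤⟨ +-mono-≤ (∑-bounded _ (count-wide π q s M avoids))
                    (∑-bounded _ (count-wide (flip π) q s (M ᵀ) (avoids-ᵀ π M avoids))) ⟩
      q * (s ^ suc r * r) + q * (s ^ suc r * r)
        ≡⟨ cong (q * (s ^ suc r * r) +_) (sym (+-identityʳ _)) ⟩
      2 * (q * (s ^ suc r * r)) ∎

-- In blocks of side (r + 1)² the at most r² ones of a narrow block are fewer
-- than the side, which keeps the bound of the recursion linear.
side : ℕ → ℕ → ℕ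
side r zero    = 1
side r (suc J) = side r J * (suc r * suc r)

-- With s = (r + 1)² this is s^(r+1) s². The wide and tall blocks then cost exactly 2r `density` q,
-- so the recursion yields (r² + 2r) `density` q, and r² + 2r is one less than s: the constant
-- reproduces itself.
density : ℕ → ℕ
density r = (suc r * suc r) ^ suc r * (suc r * suc r * (suc r * suc r))

1≤density : ∀ r → 1 ≤ density r
1≤density r = *-mono-≤ {1} {(suc r * suc r) ^ suc r} (m^n>0 (suc r * suc r) (suc r)) (s≤s z≤n)

marcus-tardos : ∀ {r} (π : Permutation′ (suc r)) J (M : Matrix (side r J)) → Avoids π M →
                ones M ≤ density r * side r J
marcus-tardos {r} π zero    M avoids = ≤-trans (ones-≤-area M) (≤-trans (1≤density r) (≤-reflexive (sym (*-identityʳ _))))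
marcus-tardos {r} π (suc J) M avoids = begin
  ones M ≤⟨ ones-contract π q s M avoids ⟩
  r * r * ones (contract q s M) + s * s * (2 * (q * (s ^ suc r * r)))
    ≤⟨ +-monoˡ-≤ _ (*-monoʳ-≤ (r * r) (marcus-tardos π J (contract q s M) (contract-avoids π q s M avoids))) ⟩
  r * r * (density r * q) + s * s * (2 * (q * (s ^ suc r * r)))
    ≡⟨ collect r (s ^ suc r) (s * s) q ⟩
  (s ^ suc r * (s * s)) * q * (r * r + 2 * r)
    ≤⟨ *-monoʳ-≤ (density r * q) (≤-trans (n≤1+n _) (≤-reflexive (square r))) ⟩
  density r * q * s ≡⟨ *-assoc (density r) q s ⟩
  density r * (q * s) ∎
  where
  open ≤-Reasoning
  q = side r J
  s = suc r * suc r
  collect : ∀ r p t q → r * r * ((p * t) * q) + t * (2 * (q * (p * r))) ≡ p * t * q * (r * r + 2 * r)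
  collect = solve-∀
  square : ∀ r → suc (r * r + 2 * r) ≡ suc r * suc r
  square = solve-∀

count-subsingleton : ∀ {n} (p : Fin n → Bool) → (∀ i j → T (p i) → T (p j) → i ≡ j) → count p ≤ 1
count-subsingleton p unique = ≮⇒≥ λ 2≤ → distinct (select p 2 2≤)
  where
  distinct : ¬ (∃[ x ] Increasing x × (∀ i → T (p (x i))))
  distinct (x , inc , px) = <-irrefl (cong toℕ (unique _ _ (px zero) (px (suc zero)))) (inc zero (suc zero) z<s)

∑-mean : ∀ {n} (f : Fin n → ℕ) K → 1 ≤ n → sum f ≤ n * K → ∃[ i ] f i ≤ K
∑-mean {n} f K 1≤n ∑≤ with any? (λ i → f i ≤? K)
... | yes found = found
... | no none = contradiction ∑≤ (<⇒≱ (begin-strict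
  n * K       <⟨ *-monoʳ-< n {{>-nonZero 1≤n}} (n<1+n K) ⟩
  n * suc K   ≡⟨ sym (∑-const n (suc K)) ⟩
  ∑[ _ < n ] suc K ≤⟨ ∑-mono (λ i → ≰⇒> λ fi≤ → none (i , fi≤)) ⟩
  sum f ∎))
  where open ≤-Reasoning

length-filter-∷ : ∀ {A : Set} {P : A → Set} (P? : Decidable P) x xs →
                  length (filter P? (x ∷ xs)) ≡ ⟦ ⌊ P? x ⌋ ⟧ + length (filter P? xs)
length-filter-∷ P? x xs with P? x
... | yes _ = refl
... | no _  = refl

filter-keeps : ∀ {A : Set} {P Q : A → Set} (Q? : Decidable Q) → (∀ {x} → P x → Q x) →
               ∀ {xs} → Any P xs → Any P (filter Q? xs)
filter-keeps Q? P⊆Q {x ∷ xs} p with Q? x | p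
... | yes _ | here px   = here px
... | yes _ | there pxs = there (filter-keeps Q? P⊆Q pxs)
... | no ¬q | here px   = contradiction (P⊆Q px) ¬q
... | no _  | there pxs = filter-keeps Q? P⊆Q pxs

-- Colourings

-- The sum over all bⁿ colourings, in place of an expectation. Nesting the sums makes it possible to
-- condition on the colour of one position at a time.
∑ᶜ : ∀ b n → (Vec (Fin b) n → ℕ) → ℕ
∑ᶜ b zero    f = f []
∑ᶜ b (suc n) f = ∑[ c < b ] ∑ᶜ b n (λ χ → f (c ∷ χ))

∑ᶜ-mono : ∀ {b} n {f g : Vec (Fin b) n → ℕ} → (∀ χ → f χ ≤ g χ) → ∑ᶜ b n f ≤ ∑ᶜ b n g
∑ᶜ-mono zero    f≤g = f≤g []
∑ᶜ-mono (suc n) f≤g = ∑-mono λ c → ∑ᶜ-mono n λ χ → f≤g (c ∷ χ)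

∑ᶜ-const : ∀ b n c → ∑ᶜ b n (λ _ → c) ≡ b ^ n * c
∑ᶜ-const b zero    c = sym (+-identityʳ c)
∑ᶜ-const b (suc n) c = trans (trans (sum-cong-≗ {b} λ _ → ∑ᶜ-const b n c) (∑-const b _)) (sym (*-assoc b (b ^ n) c))

∑ᶜ-+ : ∀ {b} n (f g : Vec (Fin b) n → ℕ) → ∑ᶜ b n (λ χ → f χ + g χ) ≡ ∑ᶜ b n f + ∑ᶜ b n g
∑ᶜ-+ zero    f g = refl
∑ᶜ-+ (suc n) f g = trans (sum-cong-≗ λ c → ∑ᶜ-+ n (λ χ → f (c ∷ χ)) (λ χ → g (c ∷ χ))) (∑-distrib-+ (λ c → ∑ᶜ _ n (λ χ → f (c ∷ χ))) _)

∑ᶜ-* : ∀ {b} n a (f : Vec (Fin b) n → ℕ) → ∑ᶜ b n (λ χ → a * f χ) ≡ a * ∑ᶜ b n f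
∑ᶜ-* zero    a f = refl
∑ᶜ-* (suc n) a f = trans (sum-cong-≗ λ c → ∑ᶜ-* n a (λ χ → f (c ∷ χ))) (sym (*-distribˡ-sum a (λ c → ∑ᶜ _ n (λ χ → f (c ∷ χ)))))

∑ᶜ-comm : ∀ {b m} n (f : Fin m → Vec (Fin b) n → ℕ) →
          ∑ᶜ b n (λ χ → ∑[ i < m ] f i χ) ≡ ∑[ i < m ] ∑ᶜ b n (f i)
∑ᶜ-comm zero    f = refl
∑ᶜ-comm (suc n) f = trans (sum-cong-≗ λ c → ∑ᶜ-comm n (λ i χ → f i (c ∷ χ))) (∑-comm λ c i → ∑ᶜ _ n (λ χ → f i (c ∷ χ)))

-- The method of conditional expectations: each colour in turn is chosen so that the average over
-- the remaining positions stays at most `K`.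
∑ᶜ-mean : ∀ {b} n (f : Vec (Fin b) n → ℕ) K → 1 ≤ b → ∑ᶜ b n f ≤ b ^ n * K → ∃[ χ ] f χ ≤ K
∑ᶜ-mean     zero    f K 1≤b ∑≤ = [] , ≤-trans ∑≤ (≤-reflexive (+-identityʳ K))
∑ᶜ-mean {b} (suc n) f K 1≤b ∑≤
  with c , ∑ᶜ≤ ← ∑-mean (λ c → ∑ᶜ b n (λ χ → f (c ∷ χ))) (b ^ n * K) 1≤b (≤-trans ∑≤ (≤-reflexive (*-assoc b (b ^ n) K)))
  with χ , f≤ ← ∑ᶜ-mean n (λ χ → f (c ∷ χ)) K 1≤b ∑ᶜ≤ = c ∷ χ , f≤

abstract
  coloured? : ∀ {b n k} (χ : Vec (Fin b) n) (c : Fin b) (x : Fin k → Fin n) → Dec (∀ i → lookup χ (x i) ≡ c)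
  coloured? χ c x = all? λ i → lookup χ (x i) ≟ c

pred-all : ∀ {k n} (x : Fin k → Fin (suc n)) → (∀ i → zero {n = n} Fin.< x i) → ∃[ x′ ] (∀ i → x i ≡ suc (x′ i))
pred-all x 0< = (λ i → proj₁ (pos (x i) (0< i))) , (λ i → proj₂ (pos (x i) (0< i)))
  where
  pos : ∀ {n} (i : Fin (suc n)) → zero {n = n} Fin.< i → ∃[ j ] i ≡ suc j
  pos (suc i) _ = i , refl

-- Distinct positions all receive colour `c` with probability b^(-k). Since `x` increases, only its
-- first entry can be position zero: if it is, that colour is forced and one entry is used up;
-- otherwise the colour is free.
count-coloured : ∀ {b k} n (x : Fin k → Fin n) → Increasing x → ∀ c →
                 b ^ k * ∑ᶜ b n (λ χ → ⟦ ⌊ coloured? χ c x ⌋ ⟧) ≤ b ^ n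
count-coloured {b} {zero} n x inc c = begin
  1 * ∑ᶜ b n (λ χ → ⟦ ⌊ coloured? χ c x ⌋ ⟧) ≤⟨ *-monoʳ-≤ 1 (∑ᶜ-mono n λ χ → ⟦⟧≤1 _) ⟩
  1 * ∑ᶜ b n (λ χ → 1) ≡⟨ trans (*-identityˡ _) (∑ᶜ-const b n 1) ⟩
  b ^ n * 1            ≡⟨ *-identityʳ _ ⟩
  b ^ n ∎
  where open ≤-Reasoning
count-coloured {b} {suc k} zero x inc c = contradiction (x zero) λ ()
count-coloured {b} {suc k} (suc n) x inc c = first (x zero) refl
  where
  first : ∀ x₀ → x zero ≡ x₀ → b ^ suc k * ∑ᶜ b (suc n) (λ χ → ⟦ ⌊ coloured? χ c x ⌋ ⟧) ≤ b ^ suc n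
  first zero eq = begin
    b * b ^ k * ∑ᶜ b (suc n) (λ χ → ⟦ ⌊ coloured? χ c x ⌋ ⟧)
      ≤⟨ *-monoʳ-≤ (b * b ^ k) (∑-mono λ c₀ → ∑ᶜ-mono n λ χ → split c₀ χ) ⟩
    b * b ^ k * (∑[ c₀ < b ] ∑ᶜ b n (λ χ → ⟦ ⌊ c₀ ≟ c ⌋ ⟧ * ⟦ ⌊ coloured? χ c x′ ⌋ ⟧))
      ≡⟨ cong (b * b ^ k *_) (sum-cong-≗ λ c₀ → ∑ᶜ-* n ⟦ ⌊ c₀ ≟ c ⌋ ⟧ _) ⟩
    b * b ^ k * (∑[ c₀ < b ] (⟦ ⌊ c₀ ≟ c ⌋ ⟧ * rest))
      ≡⟨ cong (b * b ^ k *_) (sym (*-distribʳ-sum rest (λ c₀ → ⟦ ⌊ c₀ ≟ c ⌋ ⟧))) ⟩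
    b * b ^ k * (count (λ c₀ → ⌊ c₀ ≟ c ⌋) * rest)
      ≤⟨ *-monoʳ-≤ (b * b ^ k) (*-monoˡ-≤ rest (count-subsingleton (λ c₀ → ⌊ c₀ ≟ c ⌋) λ i j p q → trans (toWitness p) (sym (toWitness q)))) ⟩
    b * b ^ k * (1 * rest)
      ≡⟨ trans (cong (b * b ^ k *_) (*-identityˡ rest)) (*-assoc b (b ^ k) rest) ⟩
    b * (b ^ k * rest)
      ≤⟨ *-monoʳ-≤ b (count-coloured n x′ inc′ c) ⟩
    b * b ^ n ∎
    where
    open ≤-Reasoning
    shifted : ∃[ x′ ] (∀ i → x (suc i) ≡ suc (x′ i))
    shifted = pred-all (x ∘ suc) (λ i → subst (Fin._< x (suc i)) eq (inc zero (suc i) z<s))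
    x′ = proj₁ shifted
    inc′ : Increasing x′
    inc′ i j i<j = s<s⁻¹ (subst₂ Fin._<_ (proj₂ shifted i) (proj₂ shifted j) (inc (suc i) (suc j) (s<s i<j)))
    rest = ∑ᶜ b n (λ χ → ⟦ ⌊ coloured? χ c x′ ⌋ ⟧)
    split : ∀ c₀ χ → ⟦ ⌊ coloured? (c₀ ∷ χ) c x ⌋ ⟧ ≤ ⟦ ⌊ c₀ ≟ c ⌋ ⟧ * ⟦ ⌊ coloured? χ c x′ ⌋ ⟧
    split c₀ χ = ⟦⟧-≤ λ h → let mono = toWitness {a? = coloured? (c₀ ∷ χ) c x} h in
      *-mono-≤ (T⇒1≤⟦⟧ (fromWitness {a? = c₀ ≟ c} (trans (cong (lookup (c₀ ∷ χ)) (sym eq)) (mono zero))))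
               (T⇒1≤⟦⟧ (fromWitness {a? = coloured? χ c x′} (λ i → trans (cong (lookup (c₀ ∷ χ)) (sym (proj₂ shifted i))) (mono (suc i)))))
  first (suc x₀) eq = begin
    b ^ suc k * ∑ᶜ b (suc n) (λ χ → ⟦ ⌊ coloured? χ c x ⌋ ⟧)
      ≤⟨ *-monoʳ-≤ (b ^ suc k) (∑-bounded {b} rest λ c₀ → ∑ᶜ-mono n λ χ → ⟦⟧-mono (drop c₀ χ)) ⟩
    b ^ suc k * (b * rest) ≡⟨ x*yz≡y*xz (b ^ suc k) b rest ⟩
    b * (b ^ suc k * rest) ≤⟨ *-monoʳ-≤ b (count-coloured n x′ inc′ c) ⟩
    b * b ^ n ∎
    where
    open ≤-Reasoning
    x*yz≡y*xz : ∀ x y z → x * (y * z) ≡ y * (x * z)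
    x*yz≡y*xz = solve-∀
    0<x : ∀ i → zero {n = n} Fin.< x i
    0<x zero    = subst (zero {n = n} Fin.<_) (sym eq) z<s
    0<x (suc i) = <-trans (0<x zero) (inc zero (suc i) z<s)
    shifted : ∃[ x′ ] (∀ i → x i ≡ suc (x′ i))
    shifted = pred-all x 0<x
    x′ = proj₁ shifted
    inc′ : Increasing x′
    inc′ i j i<j = s<s⁻¹ (subst₂ Fin._<_ (proj₂ shifted i) (proj₂ shifted j) (inc i j i<j))
    rest = ∑ᶜ b n (λ χ → ⟦ ⌊ coloured? χ c x′ ⌋ ⟧)
    drop : ∀ c₀ χ → T ⌊ coloured? (c₀ ∷ χ) c x ⌋ → T ⌊ coloured? χ c x′ ⌋
    drop c₀ χ h = fromWitness {a? = coloured? χ c x′} λ i →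
      trans (cong (lookup (c₀ ∷ χ)) (sym (proj₂ shifted i))) (toWitness {a? = coloured? (c₀ ∷ χ) c x} h i)

module _ {E : Set} {b n r : ℕ} (pos : E → Fin (suc r) → Fin n) where

  abstract
    -- Applied with `pos` = `proj₁` to the columns of placements in a matrix, and with `pos` =
    -- `lookup` to the copies in a permutation. `Increasing` is part of the condition because the
    -- positions of a listed placement may coincide, for instance after `coarsen`, and it would then
    -- be of one colour too often.
    monochromatic? : ∀ (χ : Vec (Fin b) n) c (e : E) → Dec (Increasing (pos e) × (∀ i → lookup χ (pos e i) ≡ c))
    monochromatic? χ c e = increasing? (pos e) ×-dec coloured? χ c (pos e)

  #mono : Vec (Fin b) n → List E → ℕ
  #mono χ L = ∑[ c < b ] length (filter (monochromatic? χ c) L)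

  #mono-∷ : ∀ χ e L → #mono χ (e ∷ L) ≡ #mono χ [ e ] + #mono χ L
  #mono-∷ χ e L = trans
    (sum-cong-≗ λ c → trans (length-filter-∷ (monochromatic? χ c) e L)
      (cong (_+ length (filter (monochromatic? χ c) L)) (sym (trans (length-filter-∷ (monochromatic? χ c) e []) (+-identityʳ _)))))
    (∑-distrib-+ (λ c → length (filter (monochromatic? χ c) [ e ])) (λ c → length (filter (monochromatic? χ c) L)))

  -- Each of the b colours is taken throughout with probability at most b^(-(r+1)), which leaves
  -- b^(-r) in total. For length k = r + 1 this is the origin of the exponent k - 1.
  ∑ᶜ-#mono-[e] : 1 ≤ b → ∀ e → b ^ r * ∑ᶜ b n (λ χ → #mono χ [ e ]) ≤ b ^ n
  ∑ᶜ-#mono-[e] 1≤b e = *-cancelˡ-≤ b {{>-nonZero 1≤b}} (begin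
    b * (b ^ r * ∑ᶜ b n (λ χ → #mono χ [ e ])) ≡⟨ sym (*-assoc b (b ^ r) _) ⟩
    b ^ suc r * ∑ᶜ b n (λ χ → #mono χ [ e ])
      ≡⟨ cong (b ^ suc r *_) (∑ᶜ-comm n (λ c χ → length (filter (monochromatic? χ c) [ e ]))) ⟩
    b ^ suc r * (∑[ c < b ] ∑ᶜ b n (λ χ → length (filter (monochromatic? χ c) [ e ])))
      ≡⟨ *-distribˡ-sum (b ^ suc r) (λ c → ∑ᶜ b n (λ χ → length (filter (monochromatic? χ c) [ e ]))) ⟩
    ∑[ c < b ] (b ^ suc r * ∑ᶜ b n (λ χ → length (filter (monochromatic? χ c) [ e ])))
      ≤⟨ ∑-bounded {b} (b ^ n) single ⟩
    b * b ^ n ∎)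
    where
    open ≤-Reasoning
    single : ∀ c → b ^ suc r * ∑ᶜ b n (λ χ → length (filter (monochromatic? χ c) [ e ])) ≤ b ^ n
    single c with increasing? (pos e)
    ... | yes inc = begin
      b ^ suc r * ∑ᶜ b n (λ χ → length (filter (monochromatic? χ c) [ e ]))
        ≤⟨ *-monoʳ-≤ (b ^ suc r) (∑ᶜ-mono n λ χ → ≤-trans
             (≤-reflexive (trans (length-filter-∷ (monochromatic? χ c) e []) (+-identityʳ _)))
             (⟦⟧-mono λ h → fromWitness {a? = coloured? χ c (pos e)} (proj₂ (toWitness {a? = monochromatic? χ c e} h)))) ⟩
      b ^ suc r * ∑ᶜ b n (λ χ → ⟦ ⌊ coloured? χ c (pos e) ⌋ ⟧) ≤⟨ count-coloured n (pos e) inc c ⟩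
      b ^ n ∎
    ... | no ¬inc = begin
      b ^ suc r * ∑ᶜ b n (λ χ → length (filter (monochromatic? χ c) [ e ]))
        ≤⟨ *-monoʳ-≤ (b ^ suc r) (∑ᶜ-mono n λ χ → ≤-trans
             (≤-reflexive (trans (length-filter-∷ (monochromatic? χ c) e []) (+-identityʳ _)))
             (⟦⟧-≤ λ h → contradiction (proj₁ (toWitness {a? = monochromatic? χ c e} h)) ¬inc)) ⟩
      b ^ suc r * ∑ᶜ b n (λ χ → 0) ≡⟨ cong (b ^ suc r *_) (trans (∑ᶜ-const b n 0) (*-zeroʳ (b ^ n))) ⟩
      b ^ suc r * 0 ≡⟨ *-zeroʳ (b ^ suc r) ⟩
      0 ≤⟨ z≤n ⟩
      b ^ n ∎

  ∑ᶜ-#mono : 1 ≤ b → ∀ L → ∑ᶜ b n (λ χ → b ^ r * #mono χ L) ≤ b ^ n * length L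
  ∑ᶜ-#mono 1≤b []      = ≤-reflexive (trans (trans (∑ᶜ-* n (b ^ r) (λ χ → #mono χ []))
    (trans (cong (b ^ r *_) (trans (trans (∑ᶜ-comm n (λ (c : Fin b) (χ : Vec (Fin b) n) → 0)) (∑-const b (∑ᶜ b n (λ _ → 0)))) (trans (cong (b *_) (trans (∑ᶜ-const b n 0) (*-zeroʳ (b ^ n)))) (*-zeroʳ b)))) (*-zeroʳ (b ^ r)))) (sym (*-zeroʳ (b ^ n))))
  ∑ᶜ-#mono 1≤b (e ∷ L) = begin
    ∑ᶜ b n (λ χ → b ^ r * #mono χ (e ∷ L)) ≡⟨ ∑ᶜ-* n (b ^ r) (λ χ → #mono χ (e ∷ L)) ⟩
    b ^ r * ∑ᶜ b n (λ χ → #mono χ (e ∷ L))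
      ≤⟨ *-monoʳ-≤ (b ^ r) (∑ᶜ-mono n λ χ → ≤-reflexive (#mono-∷ χ e L)) ⟩
    b ^ r * ∑ᶜ b n (λ χ → #mono χ [ e ] + #mono χ L)
      ≡⟨ cong (b ^ r *_) (∑ᶜ-+ n (λ χ → #mono χ [ e ]) (λ χ → #mono χ L)) ⟩
    b ^ r * (∑ᶜ b n (λ χ → #mono χ [ e ]) + ∑ᶜ b n (λ χ → #mono χ L))
      ≡⟨ *-distribˡ-+ (b ^ r) _ _ ⟩
    b ^ r * ∑ᶜ b n (λ χ → #mono χ [ e ]) + b ^ r * ∑ᶜ b n (λ χ → #mono χ L)
      ≤⟨ +-mono-≤ (∑ᶜ-#mono-[e] 1≤b e) (≤-trans (≤-reflexive (sym (∑ᶜ-* n (b ^ r) (λ χ → #mono χ L)))) (∑ᶜ-#mono 1≤b L)) ⟩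
    b ^ n + b ^ n * length L ≡⟨ sym (*-suc (b ^ n) (length L)) ⟩
    b ^ n * suc (length L) ∎
    where open ≤-Reasoning

  colouring : 1 ≤ b → ∀ L → ∃[ χ ] b ^ r * #mono χ L ≤ length L
  colouring 1≤b L = ∑ᶜ-mean n (λ χ → b ^ r * #mono χ L) (length L) 1≤b (∑ᶜ-#mono 1≤b L)

-- Supersaturation

Placement : ℕ → ℕ → Set
Placement k a = (Fin k → Fin a) × (Fin k → Fin a)

-- The length of such a list is an upper bound for the number of occurrences. Repetitions and
-- entries that are no occurrences are allowed, so that the image of the list under a contraction
-- again covers.
Covers : ∀ {k a} → Permutation′ k → Matrix a → List (Placement k a) → Set
Covers π M L = ∀ {x y} → Occurrence π M x y → Any (λ e → proj₁ e ≗ x × proj₂ e ≗ y) L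

erase : ∀ {a} → Fin a → Fin a → Matrix a → Matrix a
erase p q M x y = M x y ∧ not (⌊ x ≟ p ⌋ ∧ ⌊ y ≟ q ⌋)

ones-erase : ∀ {a} p q (M : Matrix a) → ones M ≤ suc (ones (erase p q M))
ones-erase {a} p q M = begin
  ones M ≤⟨ ∑-mono (λ x → ∑-mono (λ y → entry (M x y) ⌊ x ≟ p ⌋ ⌊ y ≟ q ⌋)) ⟩
  ∑[ x < a ] ∑[ y < a ] (⟦ ⌊ x ≟ p ⌋ ⟧ * ⟦ ⌊ y ≟ q ⌋ ⟧ + ⟦ erase p q M x y ⟧)
    ≡⟨ trans (sum-cong-≗ λ x → ∑-distrib-+ (λ y → ⟦ ⌊ x ≟ p ⌋ ⟧ * ⟦ ⌊ y ≟ q ⌋ ⟧) (λ y → ⟦ erase p q M x y ⟧))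
         (∑-distrib-+ (λ x → ∑[ y < a ] (⟦ ⌊ x ≟ p ⌋ ⟧ * ⟦ ⌊ y ≟ q ⌋ ⟧)) (count ∘ erase p q M)) ⟩
  ∑[ x < a ] ∑[ y < a ] (⟦ ⌊ x ≟ p ⌋ ⟧ * ⟦ ⌊ y ≟ q ⌋ ⟧) + ones (erase p q M)
    ≡⟨ cong (_+ ones (erase p q M)) (trans (sum-cong-≗ λ x → sym (*-distribˡ-sum ⟦ ⌊ x ≟ p ⌋ ⟧ (λ y → ⟦ ⌊ y ≟ q ⌋ ⟧)))
         (sym (*-distribʳ-sum (count (λ y → ⌊ y ≟ q ⌋)) (λ x → ⟦ ⌊ x ≟ p ⌋ ⟧)))) ⟩
  count (λ x → ⌊ x ≟ p ⌋) * count (λ y → ⌊ y ≟ q ⌋) + ones (erase p q M)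
    ≤⟨ +-monoˡ-≤ (ones (erase p q M)) (*-mono-≤ (singleton p) (singleton q)) ⟩
  suc (ones (erase p q M)) ∎
  where
  open ≤-Reasoning
  singleton : ∀ p → count (λ x → ⌊ x ≟ p ⌋) ≤ 1
  singleton p = count-subsingleton (λ x → ⌊ x ≟ p ⌋) λ i j hi hj → trans (toWitness hi) (sym (toWitness hj))
  entry : ∀ m b c → ⟦ m ⟧ ≤ ⟦ b ⟧ * ⟦ c ⟧ + ⟦ m ∧ not (b ∧ c) ⟧
  entry false b     c     = z≤n
  entry true  false c     = ≤-refl
  entry true  true  false = ≤-refl
  entry true  true  true  = ≤-refl

ones-covered : ∀ {r} J (π : Permutation′ (suc r)) (M : Matrix (side r J)) L → Covers π M L →
               ones M ≤ density r * side r J + length L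
ones-covered {r} J π M [] covers = ≤-trans (marcus-tardos π J M avoids) (m≤m+n _ _)
  where
  avoids : Avoids π M
  avoids occ with () ← covers occ
ones-covered {r} J π M (e ∷ L) covers = begin
  ones M                                       ≤⟨ ones-erase p q M ⟩
  suc (ones (erase p q M))                     ≤⟨ s≤s (ones-covered J π (erase p q M) L covers′) ⟩
  suc (density r * side r J + length L)        ≡⟨ sym (+-suc _ _) ⟩
  density r * side r J + suc (length L) ∎
  where
  open ≤-Reasoning
  -- Any entry of the placement would do: once it is erased, no occurrence equals `e`, so the rest
  -- of the list covers.
  p = proj₁ e zero
  q = proj₂ e zero
  covers′ : Covers π (erase p q M) L
  covers′ {x} {y} (occurrence inc ord mk) with covers (occurrence inc ord (λ i → proj₁ (T-∧⁻ {M (x i) (y i)} (mk i))))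
  ... | there h = h
  ... | here (p≡ , q≡) with x zero ≟ p | y zero ≟ q | proj₂ (T-∧⁻ {M (x zero) (y zero)} (mk zero))
  ...   | no ¬p | _     | _ = contradiction (sym (p≡ zero)) ¬p
  ...   | yes _ | no ¬q | _ = contradiction (sym (q≡ zero)) ¬q
  ...   | yes _ | yes _ | ()

module _ {r J : ℕ} (π : Permutation′ (suc (suc r))) (M : Matrix (side (suc r) J)) (L : List (Placement (suc (suc r)) (side (suc r) J)))
         (covers : Covers π M L) where

  -- Some colouring of the columns by d colours leaves at most `length L` / d^(k-1) listed
  -- placements monochromatic. Each colour class then obeys `ones-covered` with its own part of the
  -- list. As k ≥ 2 the saving is at least d, which suffices for the geometric series in
  -- `length-encode`.
  supersaturation : ∀ d → 1 ≤ d → d * ones M ≤ d * d * (density (suc r) * side (suc r) J) + length L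
  supersaturation d 1≤d with χ , few ← colouring proj₁ 1≤d L = begin
    d * ones M ≤⟨ *-monoʳ-≤ d (≤-trans (∑-mono λ x → ∑-mono λ y → classes x y) (≤-reflexive swap)) ⟩
    d * (∑[ c < d ] ones (class c))
      ≤⟨ *-monoʳ-≤ d (∑-mono λ c → ones-covered J π (class c) (L′ c) (covers′ c)) ⟩
    d * (∑[ c < d ] (C + length (L′ c)))
      ≡⟨ cong (d *_) (trans (∑-distrib-+ {d} (λ _ → C) (length ∘ L′)) (cong (_+ #mono proj₁ χ L) (∑-const d C))) ⟩
    d * (d * C + #mono proj₁ χ L) ≡⟨ trans (*-distribˡ-+ d (d * C) _) (cong (_+ d * #mono proj₁ χ L) (sym (*-assoc d d C))) ⟩
    d * d * C + d * #mono proj₁ χ L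
      ≤⟨ +-monoʳ-≤ (d * d * C) (≤-trans (*-monoˡ-≤ (#mono proj₁ χ L) (m≤m*n d (d ^ r) {{m^n≢0 d r {{>-nonZero 1≤d}}}})) few) ⟩
    d * d * C + length L ∎
    where
    open ≤-Reasoning
    C = density (suc r) * side (suc r) J
    a = side (suc r) J
    class : Fin d → Matrix a
    class c x y = M x y ∧ ⌊ lookup χ x ≟ c ⌋
    L′ : Fin d → List (Placement (suc (suc r)) a)
    L′ c = filter (monochromatic? proj₁ χ c) L
    classes : ∀ x y → ⟦ M x y ⟧ ≤ ∑[ c < d ] ⟦ class c x y ⟧
    classes x y = ⟦⟧-≤ λ h → ≤-trans
      (T⇒1≤⟦⟧ (T-∧⁺ {M x y} h (fromWitness {a? = lookup χ x ≟ lookup χ x} refl)))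
      (∑-term (λ c → ⟦ class c x y ⟧) (lookup χ x))
    swap : ∑[ x < a ] ∑[ y < a ] ∑[ c < d ] ⟦ class c x y ⟧ ≡ ∑[ c < d ] ones (class c)
    swap = trans (sum-cong-≗ λ x → ∑-comm (λ y c → ⟦ class c x y ⟧)) (∑-comm (λ x c → count (class c x)))
    covers′ : ∀ c → Covers π (class c) (L′ c)
    covers′ c {x} {y} (occurrence inc ord mk) = filter-keeps (monochromatic? proj₁ χ c) mono (covers (occurrence inc ord λ i → proj₁ (T-∧⁻ {M (x i) (y i)} (mk i))))
      where
      mono : ∀ {e} → proj₁ e ≗ x × proj₂ e ≗ y → Increasing (proj₁ e) × (∀ i → lookup χ (proj₁ e i) ≡ c)
      mono (x≡ , _) = (λ i j i<j → subst₂ Fin._<_ (sym (x≡ i)) (sym (x≡ j)) (inc i j i<j)) ,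
        λ i → trans (cong (lookup χ) (x≡ i)) (toWitness (proj₂ (T-∧⁻ {M (x i) (y i)} (mk i))))

-- Encoding matrices

-- A family of codewords determines the encoded data, and where the
-- codeword ends, if any two members are related by Decodes.
Decodes : Set → List Bool → List Bool → Set
Decodes P u v = ∀ {w w′} → u ++ w ≡ v ++ w′ → P × w ≡ w′

-- The second codeword need only be decodable once the data of the first are known. This lets the
-- blocks of a matrix be read relative to its contraction.
decodes-++ : ∀ {P Q u v u′ v′} → Decodes P u v → (P → Decodes Q u′ v′) → Decodes (P × Q) (u ++ u′) (v ++ v′)
decodes-++ {u = u} {v} {u′} {v′} d d′ {w} {w′} eq
  with p , eq′ ← d (trans (sym (++-assoc u u′ w)) (trans eq (++-assoc v v′ w′)))
  with q , eq″ ← d′ p eq′ = (p , q) , eq″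

decodes-map : ∀ {P Q u v} → (P → Q) → Decodes P u v → Decodes Q u v
decodes-map f d eq with p , eq′ ← d eq = f p , eq′

concatᶠ : ∀ {n} → (Fin n → List Bool) → List Bool
concatᶠ {zero}  f = []
concatᶠ {suc n} f = f zero ++ concatᶠ (f ∘ suc)

length-concatᶠ : ∀ {n} (f : Fin n → List Bool) → length (concatᶠ f) ≡ ∑[ i < n ] length (f i)
length-concatᶠ {zero}  f = refl
length-concatᶠ {suc n} f = trans (length-++ (f zero)) (cong (length (f zero) +_) (length-concatᶠ (f ∘ suc)))

decodes-concatᶠ : ∀ {n} {P : Fin n → Set} {f g : Fin n → List Bool} →
                  (∀ i → Decodes (P i) (f i) (g i)) → Decodes (∀ i → P i) (concatᶠ f) (concatᶠ g)
decodes-concatᶠ {zero}  d eq = (λ ()) , eq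
decodes-concatᶠ {suc n} {P} {f} {g} d = decodes-map (λ { (p , ps) → λ { zero → p ; (suc i) → ps i } })
  (decodes-++ {u = f zero} {v = g zero} (d zero) (λ _ → decodes-concatᶠ (d ∘ suc)))

bits : ∀ {a} → Matrix a → List Bool
bits B = concatᶠ λ x → concatᶠ λ y → [ B x y ]

length-bits : ∀ {a} (B : Matrix a) → length (bits B) ≡ a * a
length-bits {a} B = trans (length-concatᶠ (λ x → concatᶠ λ y → [ B x y ]))
  (trans (sum-cong-≗ {a} λ x → trans (length-concatᶠ λ y → [ B x y ]) (trans (∑-const a 1) (*-identityʳ a))) (∑-const a a))

decodes-bits : ∀ {a} (B B′ : Matrix a) → Decodes (∀ x y → B x y ≡ B′ x y) (bits B) (bits B′)
decodes-bits B B′ = decodes-concatᶠ λ x → decodes-concatᶠ λ y → ∷-injective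

module _ (q s : ℕ) where

  -- Only nonempty blocks are spelled out. Which ones these are is known from the contraction, so
  -- the cost is s² bits per one of the contraction.
  refinement : Matrix (q * s) → Fin q → Fin q → List Bool
  refinement M X Y = if contract q s M X Y then bits (block q s M X Y) else []

  refinements : Matrix (q * s) → List Bool
  refinements M = concatᶠ λ X → concatᶠ λ Y → refinement M X Y

  length-refinements : ∀ M → length (refinements M) ≡ s * s * ones (contract q s M)
  length-refinements M = trans (length-concatᶠ (λ X → concatᶠ λ Y → refinement M X Y)) (trans
    (sum-cong-≗ λ X → trans (length-concatᶠ λ Y → refinement M X Y) (trans (sum-cong-≗ λ Y → piece X Y)
      (sym (*-distribˡ-sum (s * s) (λ Y → ⟦ contract q s M X Y ⟧)))))
    (sym (*-distribˡ-sum (s * s) (λ X → count (contract q s M X)))))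
    where
    piece : ∀ X Y → length (refinement M X Y) ≡ s * s * ⟦ contract q s M X Y ⟧
    piece X Y with contract q s M X Y
    ... | true  = trans (length-bits (block q s M X Y)) (sym (*-identityʳ (s * s)))
    ... | false = sym (*-zeroʳ (s * s))

  empty-block : ∀ M X Y → contract q s M X Y ≡ false → ∀ x y → block q s M X Y x y ≡ false
  empty-block M X Y eq x y with block q s M X Y x y in eq′
  ... | false = refl
  ... | true  with () ← subst T eq (contract⁺ q s M X Y x y (subst T (sym eq′) _))

  decodes-refinement : ∀ M M′ X Y → contract q s M X Y ≡ contract q s M′ X Y →
    Decodes (∀ x y → block q s M X Y x y ≡ block q s M′ X Y x y) (refinement M X Y) (refinement M′ X Y)
  decodes-refinement M M′ X Y c≡c′ with contract q s M X Y in eq | contract q s M′ X Y in eq′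
  ... | true  | true  = decodes-bits (block q s M X Y) (block q s M′ X Y)
  ... | false | false = λ w≡w′ → (λ x y → trans (empty-block M X Y eq x y) (sym (empty-block M′ X Y eq′ x y))) , w≡w′
  ... | true  | false = contradiction c≡c′ λ ()
  ... | false | true  = contradiction c≡c′ λ ()

  from-blocks : ∀ {M M′ : Matrix (q * s)} → (∀ X Y x y → block q s M X Y x y ≡ block q s M′ X Y x y) → ∀ x y → M x y ≡ M′ x y
  from-blocks h x y with combine-surjective {q} {s} x | combine-surjective {q} {s} y
  ... | X , x′ , refl | Y , y′ , refl = h X Y x′ y′

encode : ∀ r J → Matrix (side r J) → List Bool
encode r zero    M = [ M zero zero ]
encode r (suc J) M = encode r J (contract q s M) ++ refinements q s M
  where
  q = side r J
  s = suc r * suc r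

decodes-encode : ∀ r J (M M′ : Matrix (side r J)) → Decodes (∀ x y → M x y ≡ M′ x y) (encode r J M) (encode r J M′)
decodes-encode r zero M M′ = decodes-map (λ { h zero zero → h }) ∷-injective
decodes-encode r (suc J) M M′ = decodes-map (λ (_ , h) → from-blocks q s h)
  (decodes-++ {u = encode r J (contract q s M)} {v = encode r J (contract q s M′)}
    (decodes-encode r J (contract q s M) (contract q s M′))
    λ h → decodes-concatᶠ λ X → decodes-concatᶠ λ Y → decodes-refinement q s M M′ X Y (h X Y))
  where
  q = side r J
  s = suc r * suc r

coarsen : ∀ {k} q s → Placement k (q * s) → Placement k q
coarsen q s (x , y) = quotient s ∘ x , quotient s ∘ y

-- An occurrence in the contraction lifts to an occurrence in `M`, and the listed placement equal to
-- the latter coarsens back to the former.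
covers-contract : ∀ {r} (π : Permutation′ (suc r)) q s (M : Matrix (q * s)) L → Covers π M L →
                  Covers π (contract q s M) (map (coarsen q s) L)
covers-contract π q s M L covers {X} {Y} occ with a , b , occ′ ← lift π q s M occ =
  Any.map⁺ (Any.map (λ (x≗ , y≗) →
    (λ i → trans (cong (quotient s) (x≗ i)) (cong proj₁ (remQuot-combine {q} {s} (X i) (a i)))) ,
    (λ i → trans (cong (quotient s) (y≗ i)) (cong proj₁ (remQuot-combine {q} {s} (Y i) (b i)))))
    (covers occ′))

abstract
  -- With s = (r + 1)² this is s² · `density r`: the bits spent on each one of a contraction, times
  -- the linear bound for the number of these ones.
  rate : ℕ → ℕ
  rate r = (suc r * suc r) * (suc r * suc r) * density r

  rate≡ : ∀ r → rate r ≡ (suc r * suc r) * (suc r * suc r) * density r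
  rate≡ r = refl

1≤rate : ∀ r → 1 ≤ rate r
1≤rate r = subst (1 ≤_) (sym (rate≡ r)) (*-mono-≤ {1} {(suc r * suc r) * (suc r * suc r)} (s≤s z≤n) (1≤density r))

-- The weight p doubles with each contraction: at depth j the number of ones
-- exceeds the linear bound by at most |L| / 2ʲ, so the lengths sum to O(|L|).
length-encode : ∀ {r} (π : Permutation′ (2 + r)) J (M : Matrix (side (suc r) J)) L → Covers π M L →
  ∀ p → 1 ≤ p → p * length (encode (suc r) J M) ≤ rate (suc r) * (p * p * side (suc r) J + length L)
length-encode {r} π zero M L covers p 1≤p = begin
  p * 1           ≤⟨ *-mono-≤ (m≤m*n p p {{>-nonZero 1≤p}}) ≤-refl ⟩
  p * p * 1       ≤⟨ m≤m+n _ _ ⟩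
  p * p * 1 + length L ≡⟨ sym (*-identityˡ _) ⟩
  1 * (p * p * 1 + length L) ≤⟨ *-monoˡ-≤ (p * p * 1 + length L) (1≤rate (suc r)) ⟩
  rate (suc r) * (p * p * 1 + length L) ∎
  where open ≤-Reasoning
length-encode {r} π (suc J) M L covers p 1≤p = *-cancelˡ-≤ 2 (begin
  2 * (p * length (encode (suc r) (suc J) M))
    ≡⟨ cong (λ n → 2 * (p * n)) (trans (length-++ (encode (suc r) J M′)) (cong (length (encode (suc r) J M′) +_) (length-refinements q s M))) ⟩
  2 * (p * (len + s * s * ones M′))             ≡⟨ distribute p len (s * s) (ones M′) ⟩
  2 * p * len + s * s * (2 * p * ones M′)
    ≤⟨ +-mono-≤ (length-encode π J M′ L′ covers′ (2 * p) 1≤2p)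
                (*-monoʳ-≤ (s * s) (supersaturation {J = J} π M′ L′ covers′ (2 * p) 1≤2p)) ⟩
  K * (2 * p * (2 * p) * q + length L′) + s * s * (2 * p * (2 * p) * (D * q) + length L′)
    ≡⟨ cong (λ ℓ → K * (2 * p * (2 * p) * q + ℓ) + s * s * (2 * p * (2 * p) * (D * q) + ℓ)) (length-map (coarsen q s) L) ⟩
  K * (2 * p * (2 * p) * q + ℓ) + s * s * (2 * p * (2 * p) * (D * q) + ℓ)
    ≤⟨ +-monoʳ-≤ (K * (2 * p * (2 * p) * q + ℓ)) (≤-trans (≤-reflexive (*-distribˡ-+ (s * s) (2 * p * (2 * p) * (D * q)) ℓ))
         (+-monoʳ-≤ _ (*-monoˡ-≤ ℓ (≤-trans (m≤m*n (s * s) D {{>-nonZero (1≤density (suc r))}}) (≤-reflexive (sym (rate≡ (suc r)))))))) ⟩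
  K * (2 * p * (2 * p) * q + ℓ) + (s * s * (2 * p * (2 * p) * (D * q)) + K * ℓ)
    ≡⟨ collect (s * s) D p q ℓ (rate≡ (suc r)) ⟩
  2 * (K * (p * p * (q * 4) + ℓ))
    -- Doubling the weight multiplies p² by 4. The shrinking of the side pays for this, since s = (2
    -- + r)² ≥ 4.
    ≤⟨ *-monoʳ-≤ 2 (*-monoʳ-≤ K (+-monoˡ-≤ ℓ (*-monoʳ-≤ (p * p) (*-monoʳ-≤ q (*-mono-≤ {2} {2 + r} {2} {2 + r} (m≤m+n 2 r) (m≤m+n 2 r)))))) ⟩
  2 * (K * (p * p * (q * s) + ℓ)) ∎)
  where
  open ≤-Reasoning
  q = side (suc r) J
  s = (2 + r) * (2 + r)
  D = density (suc r)
  K = rate (suc r)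
  ℓ = length L
  M′ = contract q s M
  L′ = map (coarsen q s) L
  len = length (encode (suc r) J M′)
  covers′ : Covers π M′ L′
  covers′ = covers-contract π q s M L covers
  1≤2p : 1 ≤ 2 * p
  1≤2p = ≤-trans 1≤p (m≤m+n p _)
  distribute : ∀ p l t o → 2 * (p * (l + t * o)) ≡ 2 * p * l + t * (2 * p * o)
  distribute = solve-∀
  collect : ∀ {K} t D p q ℓ → K ≡ t * D →
            K * (2 * p * (2 * p) * q + ℓ) + (t * (2 * p * (2 * p) * (D * q)) + K * ℓ) ≡ 2 * (K * (p * p * (q * 4) + ℓ))
  collect t D p q ℓ refl = expand t D p q ℓ
    where
    expand : ∀ t D p q ℓ → t * D * (2 * p * (2 * p) * q + ℓ) + (t * (2 * p * (2 * p) * (D * q)) + t * D * ℓ)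
                         ≡ 2 * (t * D * (p * p * (q * 4) + ℓ))
    expand = solve-∀

-- Colour classes of a permutation

perm-injective : ∀ {n} (σ : Permutation′ n) {i j} → σ ⟨$⟩ʳ i ≡ σ ⟨$⟩ʳ j → i ≡ j
perm-injective σ = Injection.injective (↔⇒↣ σ)

rank : ∀ {n} → (Fin n → Bool) → Fin n → ℕ
rank p zero    = 0
rank p (suc i) = ⟦ p zero ⟧ + rank (p ∘ suc) i

rank-mono-≤ : ∀ {n} (p : Fin n → Bool) {i j} → i Fin.≤ j → rank p i ≤ rank p j
rank-mono-≤ p {zero}          i≤j       = z≤n
rank-mono-≤ p {suc i} {suc j} (s≤s i≤j) = +-monoʳ-≤ ⟦ p zero ⟧ (rank-mono-≤ (p ∘ suc) i≤j)

rank-mono-< : ∀ {n} (p : Fin n → Bool) {i j} → T (p i) → i Fin.< j → rank p i < rank p j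
rank-mono-< p {zero}  {suc j} pi i<j       = ≤-trans (T⇒1≤⟦⟧ pi) (m≤m+n _ _)
rank-mono-< p {suc i} {suc j} pi (s<s i<j) = +-monoʳ-< ⟦ p zero ⟧ (rank-mono-< (p ∘ suc) pi i<j)

rank<count : ∀ {n} (p : Fin n → Bool) {i} → T (p i) → rank p i < count p
rank<count p {zero}  pi = ≤-trans (T⇒1≤⟦⟧ pi) (m≤m+n _ _)
rank<count p {suc i} pi = +-monoʳ-< ⟦ p zero ⟧ (rank<count (p ∘ suc) pi)

rank-cancel-< : ∀ {n} (p : Fin n → Bool) {i j} → rank p i < rank p j → i Fin.< j
rank-cancel-< p lt = ≰⇒> λ j≤i → <⇒≱ lt (rank-mono-≤ p j≤i)

rank-injective : ∀ {n} (p : Fin n → Bool) {i j} → T (p i) → T (p j) → rank p i ≡ rank p j → i ≡ j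
rank-injective p {i} {j} pi pj eq with Fin.<-cmp i j
... | tri< i<j _ _ = contradiction eq (<⇒≢ (rank-mono-< p pi i<j))
... | tri≈ _ i≡j _ = i≡j
... | tri> _ _ j<i = contradiction (sym eq) (<⇒≢ (rank-mono-< p pj j<i))

crossing : ∀ (f : ℕ → ℕ) {m} B → f 0 ≤ m → m < f B → ∃[ t ] f t ≤ m × m < f (suc t)
crossing f     zero    f0≤m m<fB = contradiction f0≤m (<⇒≱ m<fB)
crossing f {m} (suc B) f0≤m m<fB with f B ≤? m
... | yes fB≤m = B , fB≤m , m<fB
... | no  fB≰m = crossing f B f0≤m (≰⇒> fB≰m)

J<side : ∀ r J → J < side (suc r) J
J<side r zero    = s≤s z≤n
J<side r (suc J) = begin
  2 + J                          ≤⟨ s≤s (m≤n+m (suc J) J) ⟩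
  suc J + suc J                  ≡⟨ cong (suc J +_) (sym (+-identityʳ (suc J))) ⟩
  2 * suc J                      ≡⟨ *-comm 2 (suc J) ⟩
  suc J * 2                      ≤⟨ *-mono-≤ (J<side r J) (*-mono-≤ {1} {2 + r} {2} {2 + r} (s≤s z≤n) (m≤m+n 2 r)) ⟩
  side (suc r) J * ((2 + r) * (2 + r)) ∎
  where open ≤-Reasoning

abstract
  -- Pads a colour class to a side that can be contracted down to 1, at the cost of a constant
  -- factor. The `suc a` accounts for empty classes, whose matrices still have positive side; summed
  -- over the classes it gives the `n + b` in `length-codeword`.
  fitting-side : ∀ r a → ∃[ J ] a ≤ side (suc r) J × side (suc r) J ≤ suc a * ((2 + r) * (2 + r))
  fitting-side r a with t , side≤ , <side ← crossing (side (suc r)) {suc a} (suc a) (s≤s z≤n) (J<side r (suc a)) =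
    suc t , ≤-trans (n≤1+n a) (<⇒≤ <side) , *-monoˡ-≤ ((2 + r) * (2 + r)) side≤

class : ∀ {b n} → Vec (Fin b) n → Fin b → Fin n → Bool
class χ c i = ⌊ lookup χ i ≟ c ⌋

∑-count-class : ∀ {b n} (χ : Vec (Fin b) n) → ∑[ c < b ] count (class χ c) ≤ n
∑-count-class {b} {n} χ = begin
  ∑[ c < b ] ∑[ i < n ] ⟦ class χ c i ⟧ ≡⟨ ∑-comm (λ c i → ⟦ class χ c i ⟧) ⟩
  ∑[ i < n ] ∑[ c < b ] ⟦ class χ c i ⟧
    ≤⟨ ∑-bounded {n} 1 (λ i → count-subsingleton (λ c → class χ c i) λ c c′ p q → trans (sym (toWitness p)) (toWitness q)) ⟩
  n * 1 ≡⟨ *-identityʳ n ⟩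
  n ∎
  where open ≤-Reasoning

-- The colours of the values: each value inherits the colour of its position. It is the part of the
-- code that tells which values belong to which class.
transport : ∀ {b n} → Permutation′ n → Vec (Fin b) n → Vec (Fin b) n
transport σ χ = tabulate λ j → lookup χ (σ ⟨$⟩ˡ j)

lookup-transport : ∀ {b n} (σ : Permutation′ n) (χ : Vec (Fin b) n) i → lookup (transport σ χ) (σ ⟨$⟩ʳ i) ≡ lookup χ i
lookup-transport σ χ i = trans (lookup∘tabulate _ (σ ⟨$⟩ʳ i)) (cong (lookup χ) (inverseˡ σ))

count-transport : ∀ {b n} (σ : Permutation′ n) (χ : Vec (Fin b) n) c → count (class (transport σ χ) c) ≡ count (class χ c)
count-transport σ χ c = trans
  (sum-cong-≗ λ j → cong (λ c′ → ⟦ ⌊ c′ ≟ c ⌋ ⟧) (lookup∘tabulate (λ j → lookup χ (σ ⟨$⟩ˡ j)) j))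
  (sym (sum-permute (⟦_⟧ ∘ class χ c) (flip σ)))

copies : ∀ {k n} → Permutation′ k → Permutation′ n → List (Vec (Fin n) k)
copies {k} {n} π σ = filter (isCopy? π σ) (tuples n k)

module _ {b n : ℕ} (r : ℕ) (χ : Vec (Fin b) n) where

  classJ : Fin b → ℕ
  classJ c = proj₁ (fitting-side r (count (class χ c)))

  classSide : Fin b → ℕ
  classSide c = side (suc r) (classJ c)

  -- The permutation matrix of the pattern that `σ` induces on the positions of colour `c`, padded
  -- by empty rows and columns.
  classMatrix : Permutation′ n → ∀ c → Matrix (classSide c)
  classMatrix σ c x y = some λ i → class χ c i ∧
    ((rank (class χ c) i ≡ᵇ toℕ x) ∧ (rank (class (transport σ χ) c) (σ ⟨$⟩ʳ i) ≡ᵇ toℕ y))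

  classMatrix⁻ : ∀ σ c x y → T (classMatrix σ c x y) →
    ∃[ i ] T (class χ c i) × rank (class χ c) i ≡ toℕ x × rank (class (transport σ χ) c) (σ ⟨$⟩ʳ i) ≡ toℕ y
  classMatrix⁻ σ c x y h with i , hᵢ ← some⁻ _ h
    with ci , h′ ← T-∧⁻ {class χ c i} hᵢ with hx , hy ← T-∧⁻ {rank (class χ c) i ≡ᵇ toℕ x} h′ =
    i , ci , ≡ᵇ⇒≡ _ _ hx , ≡ᵇ⇒≡ _ _ hy

  classMatrix⁺ : ∀ σ c x y i → T (class χ c i) → rank (class χ c) i ≡ toℕ x →
                 rank (class (transport σ χ) c) (σ ⟨$⟩ʳ i) ≡ toℕ y → T (classMatrix σ c x y)
  classMatrix⁺ σ c x y i ci hx hy = some⁺ _ i (T-∧⁺ {class χ c i} ci (T-∧⁺ {rank (class χ c) i ≡ᵇ toℕ x} (≡⇒≡ᵇ _ _ hx) (≡⇒≡ᵇ _ _ hy)))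

  class-transport : ∀ σ {c i} → T (class χ c i) → T (class (transport σ χ) c (σ ⟨$⟩ʳ i))
  class-transport σ {c} {i} ci = fromWitness (trans (lookup-transport σ χ i) (toWitness ci))

  rank<side : ∀ {c i} → T (class χ c i) → rank (class χ c) i < classSide c
  rank<side {c} ci = ≤-trans (rank<count (class χ c) ci) (proj₁ (proj₂ (fitting-side r (count (class χ c)))))

  rank′<side : ∀ σ {c i} → T (class χ c i) → rank (class (transport σ χ) c) (σ ⟨$⟩ʳ i) < classSide c
  rank′<side σ {c} ci = ≤-trans (rank<count (class (transport σ χ) c) (class-transport σ ci))
    (≤-trans (≤-reflexive (count-transport σ χ c)) (proj₁ (proj₂ (fitting-side r (count (class χ c))))))

  codeword : Permutation′ n → List Bool
  codeword σ = concatᶠ λ c → encode (suc r) (classJ c) (classMatrix σ c)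

  -- An entry of a class matrix gives the ranks of a position and of its value within their colour
  -- classes. The colouring `χ`, common to all permutations, turns the first rank into the position,
  -- and the encoded colours of the values turn the second into the value.
  code-injective : ∀ σ σ′ {w w′} → transport σ χ ≡ transport σ′ χ → codeword σ ++ w ≡ codeword σ′ ++ w′ → σ ≈ σ′
  code-injective σ σ′ v≡v′ eq i = found (classMatrix⁻ σ′ c x y (subst T (same c x y)
    (classMatrix⁺ σ c x y i ci (sym (toℕ-fromℕ< _)) (sym (toℕ-fromℕ< _)))))
    where
    c = lookup χ i
    ci : T (class χ c i)
    ci = fromWitness refl
    x y : Fin (classSide c)
    x = fromℕ< (rank<side ci)
    y = fromℕ< (rank′<side σ ci)
    same : ∀ c x y → classMatrix σ c x y ≡ classMatrix σ′ c x y
    same = proj₁ (decodes-concatᶠ (λ c → decodes-encode (suc r) (classJ c) (classMatrix σ c) (classMatrix σ′ c)) eq)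
    found : ∃[ i′ ] T (class χ c i′) × rank (class χ c) i′ ≡ toℕ x × rank (class (transport σ′ χ) c) (σ′ ⟨$⟩ʳ i′) ≡ toℕ y →
            σ ⟨$⟩ʳ i ≡ σ′ ⟨$⟩ʳ i
    found (i′ , ci′ , hx , hy) with refl ← rank-injective (class χ c) ci′ ci (trans hx (toℕ-fromℕ< _)) =
      rank-injective (class (transport σ χ) c) (class-transport σ ci)
        (subst (λ v → T (class v c (σ′ ⟨$⟩ʳ i))) (sym v≡v′) (class-transport σ′ ci))
        (sym (trans (cong (λ v → rank (class v c) (σ′ ⟨$⟩ʳ i)) v≡v′) (trans hy (toℕ-fromℕ< _))))

  module _ (π : Permutation′ (2 + r)) (σ : Permutation′ n) where

    instance
      side-nonZero : ∀ {c} → NonZero (classSide c)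
      side-nonZero {c} = >-nonZero (≤-trans (s≤s z≤n) (J<side r (classJ c)))

    -- The reduction by `mod` serves to make the map total. It changes nothing on copies within
    -- class `c`, whose ranks are below `classSide c`.
    place : ∀ c → Vec (Fin n) (2 + r) → Placement (2 + r) (classSide c)
    place c e = (λ i → rank (class χ c) (lookup e i) mod classSide c)
              , (λ i → rank (class (transport σ χ) c) (σ ⟨$⟩ʳ lookup e i) mod classSide c)

    classCopies : ∀ c → List (Placement (2 + r) (classSide c))
    classCopies c = map (place c) (filter (monochromatic? lookup χ c) (copies π σ))

    toℕ-mod : ∀ {m a} .{{_ : NonZero a}} → m < a → toℕ (m mod a) ≡ m
    toℕ-mod {m} {a} m<a = trans (toℕ-fromℕ< (m%n<n m a)) (m<n⇒m%n≡m m<a)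

    covers-class : ∀ c → Covers π (classMatrix σ c) (classCopies c)
    covers-class c {x} {y} (occurrence inc ord mk) = Any.map⁺ (Any.map placed found)
      where
      V = class (transport σ χ) c
      point : ∀ i → ∃[ j ] T (class χ c j) × rank (class χ c) j ≡ toℕ (x i) × rank V (σ ⟨$⟩ʳ j) ≡ toℕ (y i)
      point i = classMatrix⁻ σ c (x i) (y i) (mk i)
      p : Fin (2 + r) → Fin n
      p i = proj₁ (point i)
      in-class : ∀ i → T (class χ c (p i))
      in-class i = proj₁ (proj₂ (point i))
      rank-x : ∀ i → rank (class χ c) (p i) ≡ toℕ (x i)
      rank-x i = proj₁ (proj₂ (proj₂ (point i)))
      rank-y : ∀ i → rank V (σ ⟨$⟩ʳ p i) ≡ toℕ (y i)
      rank-y i = proj₂ (proj₂ (proj₂ (point i)))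
      e = tabulate p
      e≡p : ∀ i → lookup e i ≡ p i
      e≡p = lookup∘tabulate p
      e-inc : ∀ i j → i Fin.< j → lookup e i Fin.< lookup e j
      e-inc i j i<j = subst₂ Fin._<_ (sym (e≡p i)) (sym (e≡p j))
        (rank-cancel-< (class χ c) (subst₂ _<_ (sym (rank-x i)) (sym (rank-x j)) (inc i j i<j)))
      σp-mono : ∀ i j → (π ⟨$⟩ʳ i) Fin.< (π ⟨$⟩ʳ j) → (σ ⟨$⟩ʳ p i) Fin.< (σ ⟨$⟩ʳ p j)
      σp-mono i j lt = rank-cancel-< V (subst₂ _<_ (sym (rank-y i)) (sym (rank-y j)) (ord i j lt))
      -- An occurrence yields only the implication from π to σ. The converse holds because values of
      -- π are linearly ordered and π is injective.
      σp-cancel : ∀ i j → (σ ⟨$⟩ʳ p i) Fin.< (σ ⟨$⟩ʳ p j) → (π ⟨$⟩ʳ i) Fin.< (π ⟨$⟩ʳ j)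
      σp-cancel i j lt with Fin.<-cmp (π ⟨$⟩ʳ i) (π ⟨$⟩ʳ j)
      ... | tri< π< _ _ = π<
      ... | tri≈ _ π≡ _ = contradiction (cong (λ i → toℕ (σ ⟨$⟩ʳ p i)) (perm-injective π π≡)) (<⇒≢ lt)
      ... | tri> _ _ π> = contradiction (σp-mono j i π>) (<-asym lt)
      e-copy : IsCopy π σ e
      e-copy = isCopy e-inc λ i j → mk⇔
        (λ lt → subst₂ (λ a b → (σ ⟨$⟩ʳ a) Fin.< (σ ⟨$⟩ʳ b)) (sym (e≡p i)) (sym (e≡p j)) (σp-mono i j lt))
        (λ lt → σp-cancel i j (subst₂ (λ a b → (σ ⟨$⟩ʳ a) Fin.< (σ ⟨$⟩ʳ b)) (e≡p i) (e≡p j) lt))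
      found : e ∈ filter (monochromatic? lookup χ c) (copies π σ)
      found = ∈-filter⁺ (monochromatic? lookup χ c) (∈-filter⁺ (isCopy? π σ) (∈-tuples e) e-copy)
        (e-inc , λ i → trans (cong (lookup χ) (e≡p i)) (toWitness (in-class i)))
      placed : ∀ {e′} → e ≡ e′ → proj₁ (place c e′) ≗ x × proj₂ (place c e′) ≗ y
      placed refl =
        (λ i → toℕ-injective (trans (cong (λ a → toℕ (rank (class χ c) a mod classSide c)) (e≡p i))
                 (trans (toℕ-mod (rank<side (in-class i))) (rank-x i)))) ,
        (λ i → toℕ-injective (trans (cong (λ a → toℕ (rank V (σ ⟨$⟩ʳ a) mod classSide c)) (e≡p i))
                 (trans (toℕ-mod (rank′<side σ (in-class i))) (rank-y i))))

    length-codeword : length (codeword σ) ≤ rate (suc r) * ((n + b) * ((2 + r) * (2 + r)) + #mono lookup χ (copies π σ))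
    length-codeword = begin
      length (codeword σ) ≡⟨ length-concatᶠ (λ c → encode (suc r) (classJ c) (classMatrix σ c)) ⟩
      ∑[ c < b ] length (encode (suc r) (classJ c) (classMatrix σ c)) ≤⟨ ∑-mono piece ⟩
      ∑[ c < b ] (K * (suc (count (class χ c)) * s + length (mono c)))
        ≡⟨ sym (*-distribˡ-sum K (λ c → suc (count (class χ c)) * s + length (mono c))) ⟩
      K * (∑[ c < b ] (suc (count (class χ c)) * s + length (mono c)))
        ≡⟨ cong (K *_) (trans (∑-distrib-+ (λ c → suc (count (class χ c)) * s) (length ∘ mono))
             (cong (_+ #mono lookup χ (copies π σ)) (sym (*-distribʳ-sum s (λ c → suc (count (class χ c))))))) ⟩
      K * ((∑[ c < b ] suc (count (class χ c))) * s + #mono lookup χ (copies π σ))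
        ≤⟨ *-monoʳ-≤ K (+-monoˡ-≤ (#mono lookup χ (copies π σ)) (*-monoˡ-≤ s sizes)) ⟩
      K * ((n + b) * s + #mono lookup χ (copies π σ)) ∎
      where
      open ≤-Reasoning
      K = rate (suc r)
      s = (2 + r) * (2 + r)
      mono : ∀ c → List (Vec (Fin n) (2 + r))
      mono c = filter (monochromatic? lookup χ c) (copies π σ)
      piece : ∀ c → length (encode (suc r) (classJ c) (classMatrix σ c)) ≤ K * (suc (count (class χ c)) * s + length (mono c))
      piece c = begin
        length (encode (suc r) (classJ c) (classMatrix σ c))  ≡⟨ sym (*-identityˡ _) ⟩
        1 * length (encode (suc r) (classJ c) (classMatrix σ c))
          ≤⟨ length-encode π (classJ c) (classMatrix σ c) (classCopies c) (covers-class c) 1 ≤-refl ⟩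
        K * (1 * 1 * classSide c + length (classCopies c))
          ≤⟨ *-monoʳ-≤ K (+-mono-≤ (≤-trans (≤-reflexive (*-identityˡ (classSide c))) (proj₂ (proj₂ (fitting-side r (count (class χ c))))))
               (≤-reflexive (length-map (place c) (mono c)))) ⟩
        K * (suc (count (class χ c)) * s + length (mono c)) ∎
      sizes : ∑[ c < b ] suc (count (class χ c)) ≤ n + b
      sizes = begin
        ∑[ c < b ] suc (count (class χ c)) ≡⟨ ∑-distrib-+ {b} (λ _ → 1) (λ c → count (class χ c)) ⟩
        ∑[ _ < b ] 1 + ∑[ c < b ] count (class χ c) ≤⟨ +-mono-≤ (≤-reflexive (trans (∑-const b 1) (*-identityʳ b))) (∑-count-class χ) ⟩
        b + n ≡⟨ +-comm b n ⟩
        n + b ∎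

-- Counting permutations by their codes

extract : ∀ {Y : Set} {P : Y → Set} {ys} → Any P ys → ∃[ y ] ∃[ ys′ ]
          P y × length ys ≡ suc (length ys′) × (∀ {Q : Y → Set} → Any Q ys → Q y ⊎ Any Q ys′)
extract {ys = y ∷ ys} (here py) = y , ys , py , refl , λ { (here q) → inj₁ q ; (there q) → inj₂ q }
extract {ys = z ∷ ys} (there p) with y , ys′ , py , eq , rest ← extract p =
  y , z ∷ ys′ , py , cong suc eq , λ { (here q) → inj₂ (here q) ; (there q) → Sum.map₂ there (rest q) }

-- Pigeonhole for lists. `R` is a relation so that a code need only exist, and distinctness is taken
-- with respect to `_~_` because permutations are compared by `_≈_`.
length-injection : ∀ {X Y : Set} {_~_ : X → X → Set} (R : X → Y → Set) → (∀ {x x′ y} → R x y → R x′ y → x ~ x′) →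
                   ∀ {xs ys} → AllPairs (λ x x′ → ¬ (x ~ x′)) xs → All (λ x → Any (R x) ys) xs → length xs ≤ length ys
length-injection R inj []       []       = z≤n
length-injection {X} {Y} {_~_} R inj {x ∷ xs} {ys} (x≁ ∷ xs≁) (h ∷ hs) with y , ys′ , rxy , eq , rest ← extract h =
  ≤-trans (s≤s (length-injection R inj xs≁ (All.zipWith others (x≁ , hs)))) (≤-reflexive (sym eq))
  where
  others : ∀ {x′} → ¬ (x ~ x′) × Any (R x′) ys → Any (R x′) ys′
  others (x≁x′ , h′) with rest h′
  ... | inj₁ rx′y = contradiction (inj rxy rx′y) x≁x′
  ... | inj₂ h″   = h″

toBits : ∀ {Λ} → Vec (Fin 2) Λ → List Bool
toBits []            = []
toBits (zero  ∷ u) = false ∷ toBits u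
toBits (suc _ ∷ u) = true ∷ toBits u

-- Brings all codewords to one length. The padding does no harm, since `Decodes` admits arbitrary
-- continuations.
pad : ∀ (u : List Bool) Λ → length u ≤ Λ → ∃[ v ] ∃[ w ] u ++ w ≡ toBits {Λ} v
pad []          zero    _       = [] , [] , refl
pad []          (suc Λ) _       with v , w , eq ← pad [] Λ z≤n = zero ∷ v , false ∷ w , cong (false ∷_) eq
pad (false ∷ u) (suc Λ) (s≤s h) with v , w , eq ← pad u Λ h = zero ∷ v , w , cong (false ∷_) eq
pad (true  ∷ u) (suc Λ) (s≤s h) with v , w , eq ← pad u Λ h = suc zero ∷ v , w , cong (true ∷_) eq

codeLength : ℕ → ℕ → ℕ → ℕ → ℕ
codeLength r n b R = rate (suc r) * ((n + b) * ((2 + r) * (2 + r)) + R)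

count-few-mono : ∀ {r b n} (π : Permutation′ (2 + r)) (χ : Vec (Fin b) n) R {G : List (Permutation′ n)} →
  AllPairs (λ σ σ′ → ¬ (σ ≈ σ′)) G → All (λ σ → #mono lookup χ (copies π σ) ≤ R) G →
  length G ≤ b ^ n * 2 ^ codeLength r n b R
count-few-mono {r} {b} {n} π χ R {G} G! few = ≤-trans
  (length-injection Codes (λ {σ} {σ′} → injective {σ} {σ′}) {ys = cartesianProduct (tuples b n) (tuples 2 Λ)} G! (All.map coded few))
  (≤-reflexive (trans (length-cartesianProductWith _,_ (tuples b n) (tuples 2 Λ)) (cong₂ _*_ (length-tuples b n) (length-tuples 2 Λ))))
  where
  Λ = codeLength r n b R
  Codes : Permutation′ n → Vec (Fin b) n × Vec (Fin 2) Λ → Set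
  Codes σ (v , u) = v ≡ transport σ χ × (∃[ w ] codeword r χ σ ++ w ≡ toBits u)
  injective : ∀ {σ σ′ y} → Codes σ y → Codes σ′ y → σ ≈ σ′
  injective {σ} {σ′} (v , _ , u) (v′ , _ , u′) = code-injective r χ σ σ′ (trans (sym v) v′) (trans u (sym u′))
  coded : ∀ {σ} → #mono lookup χ (copies π σ) ≤ R → Any (Codes σ) (cartesianProduct (tuples b n) (tuples 2 Λ))
  coded {σ} h = padded (pad (codeword r χ σ) Λ (≤-trans (length-codeword r χ π σ) (*-monoʳ-≤ (rate (suc r)) (+-monoʳ-≤ _ h))))
    where
    padded : ∃[ u ] ∃[ w ] codeword r χ σ ++ w ≡ toBits {Λ} u → Any (Codes σ) (cartesianProduct (tuples b n) (tuples 2 Λ))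
    padded (u , w , eq) = Any.map (λ { refl → refl , w , eq }) (∈-cartesianProduct⁺ (∈-tuples (transport σ χ)) (∈-tuples u))

-- Markov's inequality: an element outside `P` contributes at least `c` to the sum of `f`.
markov : ∀ {A : Set} {P : A → Set} (P? : Decidable P) (f : A → ℕ) c → (∀ x → ¬ P x → c ≤ f x) →
         ∀ xs → c * length xs ≤ c * length (filter P? xs) + List.sum (map f xs)
markov P? f c heavy []       = ≤-trans (≤-reflexive (*-zeroʳ c)) z≤n
markov P? f c heavy (x ∷ xs) with P? x
... | yes _ = begin
  c * suc (length xs)                            ≡⟨ *-suc c (length xs) ⟩
  c + c * length xs                              ≤⟨ +-monoʳ-≤ c (markov P? f c heavy xs) ⟩
  c + (c * length (filter P? xs) + List.sum (map f xs)) ≤⟨ +-monoʳ-≤ c (+-monoʳ-≤ (c * length (filter P? xs)) (m≤n+m _ (f x))) ⟩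
  c + (c * length (filter P? xs) + (f x + List.sum (map f xs))) ≡⟨ sym (+-assoc c _ _) ⟩
  c + c * length (filter P? xs) + (f x + List.sum (map f xs))   ≡⟨ cong (_+ (f x + List.sum (map f xs))) (sym (*-suc c _)) ⟩
  c * suc (length (filter P? xs)) + (f x + List.sum (map f xs)) ∎
  where open ≤-Reasoning
... | no ¬p = begin
  c * suc (length xs)                            ≡⟨ *-suc c (length xs) ⟩
  c + c * length xs                              ≤⟨ +-mono-≤ (heavy x ¬p) (markov P? f c heavy xs) ⟩
  f x + (c * length (filter P? xs) + List.sum (map f xs)) ≡⟨ x+yz (f x) (c * length (filter P? xs)) (List.sum (map f xs)) ⟩
  c * length (filter P? xs) + (f x + List.sum (map f xs)) ∎
  where
  open ≤-Reasoning
  x+yz : ∀ x y z → x + (y + z) ≡ y + (x + z)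
  x+yz = solve-∀

#mono-++ : ∀ {b n r} (χ : Vec (Fin b) n) (L L′ : List (Vec (Fin n) (suc r))) →
           #mono lookup χ (L ++ L′) ≡ #mono lookup χ L + #mono lookup χ L′
#mono-++ {b} χ []      L′ = cong (_+ #mono lookup χ L′) (sym (trans (∑-const b 0) (*-zeroʳ b)))
#mono-++     χ (e ∷ L) L′ = trans (#mono-∷ lookup χ e (L ++ L′)) (trans (cong (#mono lookup χ [ e ] +_) (#mono-++ χ L L′))
  (trans (sym (+-assoc (#mono lookup χ [ e ]) _ _)) (cong (_+ #mono lookup χ L′) (sym (#mono-∷ lookup χ e L)))))

#monoCopies : ∀ {r b n} → Permutation′ (suc r) → Vec (Fin b) n → Permutation′ n → ℕ
#monoCopies π χ σ = #mono lookup χ (copies π σ)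

#mono-concatMap : ∀ {r b n} (π : Permutation′ (suc r)) (χ : Vec (Fin b) n) S →
                  #mono lookup χ (concatMap (copies π) S) ≡ List.sum (map (#monoCopies π χ) S)
#mono-concatMap {b = b} π χ []      = trans (∑-const b 0) (*-zeroʳ b)
#mono-concatMap         π χ (σ ∷ S) = trans (#mono-++ χ (copies π σ) _) (cong (#monoCopies π χ σ +_) (#mono-concatMap π χ S))

length-copies : ∀ {k n} (π : Permutation′ k) m {S : List (Permutation′ n)} → All (λ σ → #copies π σ ≤ m) S →
                length (concatMap (copies π) S) ≤ length S * m
length-copies π m []                = z≤n
length-copies π m (_∷_ {σ} {S} h hs) = ≤-trans (≤-reflexive (length-++ (copies π σ))) (+-mono-≤ h (length-copies π m hs))

module _ {r b n : ℕ} (π : Permutation′ (2 + r)) (χ : Vec (Fin b) n) where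

  light? : Decidable (λ σ → #monoCopies π χ σ ≤ 2 * n)
  light? σ = #monoCopies π χ σ ≤? 2 * n

  -- The chosen colouring leaves at most m / b^(k-1) ≤ n monochromatic copies per permutation on
  -- average; the threshold 2n in `light?` is twice this average.
  total-mono : ∀ {m} → 1 ≤ b → m ≤ n * b ^ suc r → ∀ {S} → All (λ σ → #copies π σ ≤ m) S →
               b ^ suc r * #mono lookup χ (concatMap (copies π) S) ≤ length (concatMap (copies π) S) →
               List.sum (map (#monoCopies π χ) S) ≤ length S * n
  total-mono {m} 1≤b m≤ {S} few sparse = *-cancelˡ-≤ (b ^ suc r) {{m^n≢0 b (suc r) {{>-nonZero 1≤b}}}} (begin
    b ^ suc r * List.sum (map (#monoCopies π χ) S) ≡⟨ cong (b ^ suc r *_) (sym (#mono-concatMap π χ S)) ⟩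
    b ^ suc r * #mono lookup χ (concatMap (copies π) S) ≤⟨ sparse ⟩
    length (concatMap (copies π) S)        ≤⟨ length-copies π m few ⟩
    length S * m                           ≤⟨ *-monoʳ-≤ (length S) m≤ ⟩
    length S * (n * b ^ suc r)             ≡⟨ rearrange (length S) n (b ^ suc r) ⟩
    b ^ suc r * (length S * n) ∎)
    where
    open ≤-Reasoning
    rearrange : ∀ x y z → x * (y * z) ≡ z * (x * y)
    rearrange = solve-∀

-- A permutation that is not light has at least 2n + 1 monochromatic copies while the average is at
-- most n, so (n + 1) l ≤ (2n + 1) g, and 2n + 1 < 2 (n + 1). Using 2n + 1 rather than 2n also
-- covers n = 0.
halve : ∀ n l g {w} → suc (2 * n) * l ≤ suc (2 * n) * g + w → w ≤ l * n → l ≤ 2 * g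
halve n l g {w} h w≤ = *-cancelˡ-≤ (suc n) (+-cancelʳ-≤ (l * n) _ _ (begin
  suc n * l + l * n             ≡⟨ double n l ⟩
  suc (2 * n) * l               ≤⟨ h ⟩
  suc (2 * n) * g + w           ≤⟨ +-mono-≤ (*-monoˡ-≤ g (n≤1+n (suc (2 * n)))) w≤ ⟩
  suc (suc (2 * n)) * g + l * n ≡⟨ cong (_+ l * n) (twice n g) ⟩
  suc n * (2 * g) + l * n ∎))
  where
  open ≤-Reasoning
  double : ∀ n l → suc n * l + l * n ≡ suc (2 * n) * l
  double = solve-∀
  twice : ∀ n g → suc (suc (2 * n)) * g ≡ suc n * (2 * g)
  twice = solve-∀

-- The colouring must not depend on the permutation, or recording it would
-- square the main factor bⁿ: averaging gives one that serves half of S.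
count-few-copies : ∀ {r n} (π : Permutation′ (2 + r)) m b → 1 ≤ b → m ≤ n * b ^ suc r → ∀ {S : List (Permutation′ n)} →
  AllPairs (λ σ σ′ → ¬ (σ ≈ σ′)) S → All (λ σ → #copies π σ ≤ m) S →
  length S ≤ 2 * (b ^ n * 2 ^ codeLength r n b (2 * n))
count-few-copies {r} {n} π m b 1≤b m≤ {S} S! few = serve (colouring lookup 1≤b (concatMap (copies π) S))
  where
  serve : ∃[ χ ] b ^ suc r * #mono lookup χ (concatMap (copies π) S) ≤ length (concatMap (copies π) S) →
          length S ≤ 2 * (b ^ n * 2 ^ codeLength r n b (2 * n))
  serve (χ , sparse) = ≤-trans
    (halve n (length S) (length (filter (light? π χ) S)) (markov (light? π χ) (#monoCopies π χ) (suc (2 * n)) (λ σ → ≰⇒>) S)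
      (total-mono π χ 1≤b m≤ few sparse))
    (*-monoʳ-≤ 2 (count-few-mono π χ (2 * n) (AllPairs.filter⁺ (light? π χ) S!) (All.all-filter (light? π χ) S)))

-- The lower bound

toℕ-punchIn-≥ : ∀ {n} (i : Fin (suc n)) (j : Fin n) → toℕ i ≤ toℕ j → toℕ (punchIn i j) ≡ suc (toℕ j)
toℕ-punchIn-≥ zero    j       i≤j       = refl
toℕ-punchIn-≥ (suc i) (suc j) (s≤s i≤j) = cong suc (toℕ-punchIn-≥ i j i≤j)

punchIn-mono-< : ∀ {n} (i : Fin (suc n)) {j k : Fin n} → j Fin.< k → punchIn i j Fin.< punchIn i k
punchIn-mono-< i {j} {k} j<k = ≰⇒> λ k≤j → <⇒≱ j<k (punchIn-cancel-≤ i k j k≤j)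

Local : ∀ {n} → ℕ → Permutation′ n → Set
Local t σ = ∀ i j → t + toℕ i < toℕ j → (σ ⟨$⟩ʳ i) Fin.< (σ ⟨$⟩ʳ j)

-- As `σ` is a bijection, for u ≤ n this says that its first u entries form a direct summand.
PreservesFrom : ∀ {n} → ℕ → Permutation′ n → Set
PreservesFrom u σ = ∀ j → u ≤ toℕ j → u ≤ toℕ (σ ⟨$⟩ʳ j)

module _ {n u t : ℕ} (a : Fin (suc n)) (ρ : Permutation′ n) (a≤u : toℕ a ≤ u) where

  insert-preserves : PreservesFrom u ρ → PreservesFrom (suc u) (insert zero a ρ)
  insert-preserves pres (suc j) (s≤s u≤j) =
    subst (suc u ≤_) (sym (toℕ-punchIn-≥ a (ρ ⟨$⟩ʳ j) (≤-trans a≤u (pres j u≤j)))) (s≤s (pres j u≤j))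

  -- A position more than `t` to the right of the new entry has index at least `u` in `ρ`, hence a
  -- value at least `u`, and so at least `a`; `punchIn` then lifts that value above `a`.
  insert-local : u ≤ t → PreservesFrom u ρ → Local t ρ → Local t (insert zero a ρ)
  insert-local u≤t pres local zero (suc j) (s≤s t≤j) =
    subst (toℕ a <_) (sym (toℕ-punchIn-≥ a (ρ ⟨$⟩ʳ j) (≤-trans a≤u u≤ρj))) (s≤s (≤-trans a≤u u≤ρj))
    where
    u≤ρj : u ≤ toℕ (ρ ⟨$⟩ʳ j)
    u≤ρj = pres j (≤-trans u≤t (≤-trans (m≤m+n t 0) t≤j))
  insert-local u≤t pres local (suc i) (suc j) t+i<j =
    punchIn-mono-< a (local i j (s<s⁻¹ (subst (_< suc (toℕ j)) (+-suc t (toℕ i)) t+i<j)))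

insert-injective : ∀ {n} {i j : Fin (suc n)} {π ρ : Permutation′ n} →
                   insert zero i π ≈ insert zero j ρ → i ≡ j × π ≈ ρ
insert-injective {i = i} {π = π} {ρ} p with p zero
... | refl = refl , λ x → punchIn-injective i (π ⟨$⟩ʳ x) (ρ ⟨$⟩ʳ x) (p (suc x))

module _ (t : ℕ) where

  choices : ∀ u n → List (Fin (suc u + n))
  choices u n = map (_↑ˡ n) (allFin (suc u))

  -- Direct sums of u + q (t + 1) points, in q blocks of size t + 1
  -- preceded by one of size u.
  blockwise : ∀ q u → List (Permutation′ (u + q * suc t))
  blockwise zero    zero    = [ id ]
  blockwise (suc q) zero    = blockwise q (suc t)
  blockwise q       (suc u) = cartesianProductWith (insert zero) (choices u (q * suc t)) (blockwise q u)

  length-blockwise : ∀ q u → length (blockwise q u) ≡ u ! * (suc t !) ^ q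
  length-blockwise zero    zero    = refl
  length-blockwise (suc q) zero    = trans (length-blockwise q (suc t)) (sym (+-identityʳ _))
  length-blockwise zero    (suc u) = trans (length-cartesianProductWith (insert zero) (choices u 0) (blockwise zero u))
    (trans (cong₂ _*_ (trans (length-map (_↑ˡ 0) (allFin (suc u))) (length-tabulate {n = suc u} (λ i → i))) (length-blockwise zero u))
      (sym (*-assoc (suc u) (u !) 1)))
  length-blockwise (suc q) (suc u) = trans (length-cartesianProductWith (insert zero) (choices u (suc q * suc t)) (blockwise (suc q) u))
    (trans (cong₂ _*_ (trans (length-map (_↑ˡ (suc q * suc t)) (allFin (suc u))) (length-tabulate {n = suc u} (λ i → i))) (length-blockwise (suc q) u))
      (sym (*-assoc (suc u) (u !) ((suc t !) ^ suc q))))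

  extend-unique : ∀ u n {L : List (Permutation′ (u + n))} → Uniqueₛ.Unique (permutationSetoid (u + n)) L →
                  Uniqueₛ.Unique (permutationSetoid (suc u + n)) (cartesianProductWith (insert zero) (choices u n) L)
  extend-unique u n L! = Uniqueₛ.cartesianProductWith⁺ (setoid _) (permutationSetoid (u + n)) (permutationSetoid (suc u + n))
    (insert zero) (λ {_} {_} {π} {ρ} → insert-injective {π = π} {ρ})
    (Unique.map⁺ (↑ˡ-injective n _ _) (Unique.allFin⁺ (suc u))) L!

  blockwise-unique : ∀ q u → Uniqueₛ.Unique (permutationSetoid (u + q * suc t)) (blockwise q u)
  blockwise-unique zero    zero    = [] ∷ []
  blockwise-unique (suc q) zero    = blockwise-unique q (suc t)
  blockwise-unique zero    (suc u) = extend-unique u 0 (blockwise-unique zero u)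
  blockwise-unique (suc q) (suc u) = extend-unique u (suc q * suc t) (blockwise-unique (suc q) u)

  extend-local : ∀ u n → u ≤ t → {L : List (Permutation′ (u + n))} → All (λ σ → Local t σ × PreservesFrom u σ) L →
                 All (λ σ → Local t σ × PreservesFrom (suc u) σ) (cartesianProductWith (insert zero) (choices u n) L)
  extend-local u n u≤t {L} h = All.cartesianProductWith⁺ (setoid _) (setoid _) (insert zero) (choices u n) L
    λ {a} {ρ} a∈ ρ∈ → let local , pres = All.lookup h ρ∈ in
      insert-local a ρ (bounded a∈) u≤t pres local , insert-preserves {t = t} a ρ (bounded a∈) pres
    where
    bounded : ∀ {a} → a ∈ choices u n → toℕ a ≤ u
    bounded a∈ with i , _ , refl ← ∈-map⁻ (_↑ˡ n) a∈ = subst (_≤ u) (sym (toℕ-↑ˡ i n)) (toℕ≤pred[n] i)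

  blockwise-local : ∀ q u → u ≤ suc t → All (λ σ → Local t σ × PreservesFrom u σ) (blockwise q u)
  blockwise-local zero    zero    _         = ((λ ()) , (λ ())) ∷ []
  blockwise-local (suc q) zero    _         = All.map (λ (local , _) → local , λ _ _ → z≤n) (blockwise-local q (suc t) ≤-refl)
  blockwise-local zero    (suc u) (s≤s u≤t) = extend-local u 0 u≤t (blockwise-local zero u (m≤n⇒m≤1+n u≤t))
  blockwise-local (suc q) (suc u) (s≤s u≤t) = extend-local u (suc q * suc t) u≤t (blockwise-local (suc q) u (m≤n⇒m≤1+n u≤t))

tuples-unique : ∀ n k → Unique (tuples n k)
tuples-unique n zero    = [] ∷ []
tuples-unique n (suc k) = Unique.cartesianProductWith⁺ _∷_ Vec.∷-injective (Unique.allFin⁺ n) (tuples-unique n k)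

lookup-injective : ∀ {A : Set} {n} {xs ys : Vec A n} → lookup xs ≗ lookup ys → xs ≡ ys
lookup-injective {xs = xs} {ys} h = trans (sym (tabulate∘lookup xs)) (trans (tabulate-cong h) (tabulate∘lookup ys))

Narrow : ∀ {r n} → ℕ → Permutation′ (2 + r) → Permutation′ n → Set
Narrow {r} t π σ = ∀ {x} → IsCopy π σ x → toℕ (lookup x (Fin.fromℕ (suc r))) ≤ t + toℕ (lookup x zero)

-- A copy is determined by its first position and the k - 1 distances of the others from it. These
-- lie between 1 and t, and are stored less one as elements of `Fin t`.
#copies-narrow : ∀ {r n} t (π : Permutation′ (2 + r)) (σ : Permutation′ n) → Narrow t π σ → #copies π σ ≤ n * t ^ suc r
#copies-narrow {r} {n} t π σ narrow = ≤-trans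
  (length-injection Offsets (λ {x} {x′} {y} → injective {x} {x′} {y}) {ys = cartesianProduct (allFin n) (tuples t (suc r))}
    (AllPairs.filter⁺ (isCopy? π σ) (tuples-unique n (2 + r))) (All.map offsets (All.all-filter (isCopy? π σ) (tuples n (2 + r)))))
  (≤-reflexive (trans (length-cartesianProductWith _,_ (allFin n) (tuples t (suc r)))
    (cong₂ _*_ (length-tabulate {n = n} (λ i → i)) (length-tuples t (suc r)))))
  where
  Offsets : Vec (Fin n) (2 + r) → Fin n × Vec (Fin t) (suc r) → Set
  Offsets x (a , o) = lookup x zero ≡ a × (∀ i → toℕ (lookup x (suc i)) ≡ suc (toℕ a) + toℕ (lookup o i))
  injective : ∀ {x x′ y} → Offsets x y → Offsets x′ y → x ≡ x′
  injective (h , hs) (h′ , hs′) = lookup-injective λ { zero → trans h (sym h′) ; (suc i) → toℕ-injective (trans (hs i) (sym (hs′ i))) }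
  offsets : ∀ {x} → IsCopy π σ x → Any (Offsets x) (cartesianProduct (allFin n) (tuples t (suc r)))
  offsets {x} copy = Any.map (λ { refl → refl , λ i → trans (sym (m+[n∸m]≡n (x₀<x i)))
      (cong (suc (toℕ (lookup x zero)) +_) (sym (trans (cong toℕ (lookup∘tabulate offset i)) (toℕ-fromℕ< _)))) })
    (∈-cartesianProduct⁺ (∈-allFin (lookup x zero)) (∈-tuples (tabulate offset)))
    where
    x₀<x : ∀ i → toℕ (lookup x zero) < toℕ (lookup x (suc i))
    x₀<x i = IsCopy.increasing copy zero (suc i) z<s
    x≤last : ∀ i → toℕ (lookup x i) ≤ toℕ (lookup x (Fin.fromℕ (suc r)))
    x≤last i with Fin.<-cmp i (Fin.fromℕ (suc r))
    ... | tri< i< _ _ = <⇒≤ (IsCopy.increasing copy i (Fin.fromℕ (suc r)) i<)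
    ... | tri≈ _ i≡ _ = ≤-reflexive (cong (toℕ ∘ lookup x) i≡)
    ... | tri> _ _ i> = contradiction (toℕ≤pred[n] i) (<⇒≱ (subst (_< toℕ i) (toℕ-fromℕ (suc r)) i>))
    near : ∀ i → toℕ (lookup x (suc i)) ∸ suc (toℕ (lookup x zero)) < t
    near i = +-cancelˡ-< (suc (toℕ (lookup x zero))) _ _ (begin-strict
      suc (toℕ (lookup x zero)) + (toℕ (lookup x (suc i)) ∸ suc (toℕ (lookup x zero))) ≡⟨ m+[n∸m]≡n (x₀<x i) ⟩
      toℕ (lookup x (suc i))            ≤⟨ ≤-trans (x≤last (suc i)) (narrow copy) ⟩
      t + toℕ (lookup x zero)           ≡⟨ +-comm t _ ⟩
      toℕ (lookup x zero) + t           <⟨ n<1+n _ ⟩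
      suc (toℕ (lookup x zero)) + t ∎)
      where open ≤-Reasoning
    offset : Fin (suc r) → Fin t
    offset i = fromℕ< (near i)

module _ {r n t : ℕ} (π : Permutation′ (2 + r)) (σ : Permutation′ n) where

  private
    first last : Fin (2 + r)
    first = zero
    last  = Fin.fromℕ (suc r)

  local⇒narrow : ¬ ((π ⟨$⟩ʳ first) Fin.< (π ⟨$⟩ʳ last)) → Local t σ → Narrow t π σ
  local⇒narrow π≮ local {x} copy = ≮⇒≥ λ far → π≮ (Equivalence.from (IsCopy.pattern⇔ copy first last) (local _ _ far))

  reverse-local⇒narrow : (π ⟨$⟩ʳ first) Fin.< (π ⟨$⟩ʳ last) →
    (∀ i j → t + toℕ i < toℕ j → (σ ⟨$⟩ʳ j) Fin.< (σ ⟨$⟩ʳ i)) → Narrow t π σ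
  reverse-local⇒narrow π< antilocal {x} copy = ≮⇒≥ λ far →
    <-asym (Equivalence.to (IsCopy.pattern⇔ copy first last) π<) (antilocal _ _ far)

opposite-anti-< : ∀ {n} {i j : Fin n} → i Fin.< j → opposite j Fin.< opposite i
opposite-anti-< {n} {i} {j} i<j = subst₂ _<_ (sym (opposite-prop j)) (sym (opposite-prop i)) (∸-monoʳ-< (s≤s i<j) (Fin.toℕ<n j))

blockwise-≤-count : ∀ {r m} t q u (π : Permutation′ (2 + r)) → u ≤ suc t → (u + q * suc t) * t ^ suc r ≤ m →
                    u ! * (suc t !) ^ q ≤ #permutationsWithAtMost m π (u + q * suc t)
blockwise-≤-count {r} {m} t q u π u≤ m≥ = ≤-trans (≤-reflexive (sym (length-blockwise t q u))) (bound ((π ⟨$⟩ʳ zero) Fin.<? (π ⟨$⟩ʳ Fin.fromℕ (suc r))))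
  where
  n = u + q * suc t
  few? : (σ : Permutation′ n) → Dec (#copies π σ ≤ m)
  few? σ = #copies π σ ≤? m
  target : List (Permutation′ n)
  target = filter few? (permutations n)
  bound : Dec ((π ⟨$⟩ʳ zero) Fin.< (π ⟨$⟩ʳ Fin.fromℕ (suc r))) → length (blockwise t q u) ≤ length target
  bound (no π≮) = length-injection {_~_ = _≈_} (λ σ ρ → σ ≈ ρ) (λ p p′ i → trans (p i) (sym (p′ i)))
    (blockwise-unique t q u) (All.map (λ {σ} (local , _) → filter-keeps few? (λ {ρ} σ≈ρ →
        ≤-trans (#copies-narrow t π ρ (local⇒narrow π ρ π≮ λ i j far → subst₂ Fin._<_ (σ≈ρ i) (σ≈ρ j) (local i j far))) m≥)
      (permutations-complete n σ)) (blockwise-local t q u u≤))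
  -- `σ ∘ₚ reverse` applies `opposite` to the values, so far-apart entries now descend. Since
  -- `opposite` is an involution, different sums remain different.
  bound (yes π<) = length-injection {_~_ = _≈_} (λ σ ρ → (σ ∘ₚ reverse) ≈ ρ)
    (λ {σ} {σ′} p p′ i → trans (sym (opposite-involutive (σ ⟨$⟩ʳ i))) (trans (cong opposite (trans (p i) (sym (p′ i)))) (opposite-involutive (σ′ ⟨$⟩ʳ i))))
    (blockwise-unique t q u) (All.map (λ {σ} (local , _) → filter-keeps few? (λ {ρ} σ≈ρ →
        ≤-trans (#copies-narrow t π ρ (reverse-local⇒narrow π ρ π< λ i j far →
          subst₂ Fin._<_ (σ≈ρ j) (σ≈ρ i) (opposite-anti-< (local i j far)))) m≥)
      (permutations-complete n (σ ∘ₚ reverse))) (blockwise-local t q u u≤))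

-- Elementary estimates and the choice of `t`

bernoulli : ∀ s u → suc s ^ suc u ≤ s ^ suc u + suc u * suc s ^ u
bernoulli s zero    = ≤-reflexive (base s)
  where
  base : ∀ s → suc s * 1 ≡ s * 1 + 1 * 1
  base = solve-∀
bernoulli s (suc u) = begin
  suc s * suc s ^ suc u                                        ≤⟨ *-monoʳ-≤ (suc s) (bernoulli s u) ⟩
  suc s * (s ^ suc u + suc u * suc s ^ u)                      ≡⟨ expand s (s ^ suc u) u (suc s ^ u) ⟩
  s ^ suc (suc u) + (s ^ suc u + suc u * suc s ^ suc u)        ≤⟨ +-monoʳ-≤ (s ^ suc (suc u)) (+-monoˡ-≤ _ (^-monoˡ-≤ (suc u) (n≤1+n s))) ⟩
  s ^ suc (suc u) + suc (suc u) * suc s ^ suc u ∎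
  where
  open ≤-Reasoning
  expand : ∀ s p u z → suc s * (p + suc u * z) ≡ s * p + (p + suc u * (suc s * z))
  expand = solve-∀

-- Replaces Stirling's formula. After division by factorials, `bernoulli` says that f(s, u) = s^u /
-- u! satisfies f(s+1, u+1) ≤ f(s, u+1) + f(s+1, u), a recursion of Pascal's kind, so f at most
-- doubles with each step of s + u.
^≤2^*! : ∀ s u → s ^ u ≤ 2 ^ (s + u) * u !
^≤2^*! s       zero    = ≤-trans (m^n>0 2 (s + 0)) (≤-reflexive (sym (*-identityʳ _)))
^≤2^*! zero    (suc u) = z≤n
^≤2^*! (suc s) (suc u) = begin
  suc s ^ suc u                                         ≤⟨ bernoulli s u ⟩
  s ^ suc u + suc u * suc s ^ u                         ≤⟨ +-mono-≤ (^≤2^*! s (suc u)) (*-monoʳ-≤ (suc u) (^≤2^*! (suc s) u)) ⟩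
  2 ^ (s + suc u) * (suc u * u !) + suc u * (2 ^ (suc s + u) * u !)
    ≡⟨ cong (λ e → 2 ^ (s + suc u) * (suc u * u !) + suc u * (2 ^ e * u !)) (sym (+-suc s u)) ⟩
  2 ^ (s + suc u) * (suc u * u !) + suc u * (2 ^ (s + suc u) * u !) ≡⟨ collect (2 ^ (s + suc u)) u (u !) ⟩
  2 ^ (suc s + suc u) * (suc u * u !) ∎
  where
  open ≤-Reasoning
  collect : ∀ p u f → p * (suc u * f) + suc u * (p * f) ≡ 2 * p * (suc u * f)
  collect = solve-∀

^-distribʳ-* : ∀ m n o → (m * n) ^ o ≡ m ^ o * n ^ o
^-distribʳ-* m n zero    = refl
^-distribʳ-* m n (suc o) = trans (cong (m * n *_) (^-distribʳ-* m n o)) (interchange m n (m ^ o) (n ^ o))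
  where
  interchange : ∀ a b c d → a * b * (c * d) ≡ a * c * (b * d)
  interchange = solve-∀

-- Each full block costs a factor 2^(2s) by `^≤2^*!`. The block of size `u` costs 2^(s+u), which is
-- where the additional `s` in the exponent comes from.
power-≤-blockwise : ∀ s q u → s ^ (u + q * s) ≤ 2 ^ (s + 2 * (u + q * s)) * (u ! * (s !) ^ q)
power-≤-blockwise s q u = begin
  s ^ (u + q * s)                                   ≡⟨ ^-distribˡ-+-* s u (q * s) ⟩
  s ^ u * s ^ (q * s)                               ≡⟨ cong (s ^ u *_) (trans (cong (s ^_) (*-comm q s)) (sym (^-*-assoc s s q))) ⟩
  s ^ u * (s ^ s) ^ q                               ≤⟨ *-mono-≤ (^≤2^*! s u) (^-monoˡ-≤ q (^≤2^*! s s)) ⟩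
  2 ^ (s + u) * u ! * (2 ^ (s + s) * s !) ^ q       ≡⟨ cong (2 ^ (s + u) * u ! *_) (trans (^-distribʳ-* (2 ^ (s + s)) (s !) q) (cong (_* (s !) ^ q) (^-*-assoc 2 (s + s) q))) ⟩
  2 ^ (s + u) * u ! * (2 ^ ((s + s) * q) * (s !) ^ q) ≡⟨ interchange (2 ^ (s + u)) (u !) (2 ^ ((s + s) * q)) ((s !) ^ q) ⟩
  2 ^ (s + u) * 2 ^ ((s + s) * q) * (u ! * (s !) ^ q) ≡⟨ cong (_* (u ! * (s !) ^ q)) (sym (^-distribˡ-+-* 2 (s + u) ((s + s) * q))) ⟩
  2 ^ (s + u + (s + s) * q) * (u ! * (s !) ^ q)
    ≤⟨ *-monoˡ-≤ (u ! * (s !) ^ q) (^-monoʳ-≤ 2 (≤-trans (m≤m+n _ u) (≤-reflexive (exponent s u q)))) ⟩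
  2 ^ (s + 2 * (u + q * s)) * (u ! * (s !) ^ q) ∎
  where
  open ≤-Reasoning
  interchange : ∀ a b c d → a * b * (c * d) ≡ a * c * (b * d)
  interchange = solve-∀
  exponent : ∀ s u q → s + u + (s + s) * q + u ≡ s + 2 * (u + q * s)
  exponent = solve-∀

nCk≤n^k : ∀ n k → n C k ≤ n ^ k
nCk≤n^k n       zero    = ≤-reflexive (trans (nCk≡nC[n∸k] {0} {n} z≤n) (nCn≡1 n))
nCk≤n^k zero    (suc k) = ≤-reflexive (k>n⇒nCk≡0 {0} {suc k} z<s)
nCk≤n^k (suc n) (suc k) = begin
  suc n C suc k          ≡⟨ sym (nCk+nC[k+1]≡[n+1]C[k+1] n k) ⟩
  n C k + n C suc k      ≤⟨ +-mono-≤ (nCk≤n^k n k) (nCk≤n^k n (suc k)) ⟩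
  suc n * n ^ k          ≤⟨ *-monoʳ-≤ (suc n) (^-monoˡ-≤ k (n≤1+n n)) ⟩
  suc n ^ suc k ∎
  where open ≤-Reasoning

^-cancelʳ-≤ : ∀ r {m n} → m ^ suc r ≤ n ^ suc r → m ≤ n
^-cancelʳ-≤ r h = ≮⇒≥ λ n<m → <⇒≱ (^-monoˡ-< (suc r) n<m) h

^-swap : ∀ m n o → (m ^ n) ^ o ≡ (m ^ o) ^ n
^-swap m n o = trans (^-*-assoc m n o) (trans (cong (m ^_) (*-comm n o)) (sym (^-*-assoc m o n)))

-- Here m ≤ C(n, k) enters: n t^(k-1) ≤ m ≤ n^k gives t ≤ n. The search by `crossing` can stop at m
-- + 1, as n (m + 1)^(k-1) exceeds m.
scale : ∀ {n} r m → 1 ≤ n → m ≤ n C (2 + r) → ∃[ t ] n * t ^ suc r ≤ m × m < n * suc t ^ suc r × t ≤ n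
scale {n@(suc n′)} r m _ m≤ with t , lower , upper ← crossing (λ t → n * t ^ suc r) (suc m) (≤-trans (≤-reflexive (*-zeroʳ n)) z≤n)
    (≤-trans (m≤m*n (suc m) (suc m ^ r) {{m^n≢0 (suc m) r}}) (m≤n*m (suc m ^ suc r) n)) =
  t , lower , upper , ^-cancelʳ-≤ r (*-cancelˡ-≤ n (≤-trans lower (≤-trans m≤ (nCk≤n^k n (2 + r)))))

-- Bits per position: one for the factor 2 lost by averaging, one for (t + 1)ⁿ ≤ (2t)ⁿ, and the code
-- length with n + b ≤ 3n and 2n monochromatic copies.
upperRate : ℕ → ℕ
upperRate r = 2 + rate (suc r) * (3 * ((2 + r) * (2 + r)) + 2)

2^1+n+code≤ : ∀ r n t → 1 ≤ n → t ≤ n → 2 * (2 ^ n * 2 ^ codeLength r n (suc t) (2 * n)) ≤ 2 ^ (upperRate r * n)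
2^1+n+code≤ r n t 1≤n t≤n = begin
  2 * (2 ^ n * 2 ^ codeLength r n (suc t) (2 * n)) ≡⟨ cong (2 *_) (sym (^-distribˡ-+-* 2 n _)) ⟩
  2 ^ (1 + (n + K * ((n + suc t) * s + 2 * n)))
    ≤⟨ ^-monoʳ-≤ 2 (+-mono-≤ 1≤n (+-monoʳ-≤ n (*-monoʳ-≤ K (+-monoˡ-≤ (2 * n) (*-monoˡ-≤ s (+-monoʳ-≤ n (+-mono-≤ 1≤n t≤n))))))) ⟩
  2 ^ (n + (n + K * ((n + (n + n)) * s + 2 * n)))  ≡⟨ cong (2 ^_) (collect K s n) ⟩
  2 ^ (upperRate r * n) ∎
  where
  open ≤-Reasoning
  K = rate (suc r)
  s = (2 + r) * (2 + r)
  collect : ∀ K s n → n + (n + K * ((n + (n + n)) * s + 2 * n)) ≡ (2 + K * (3 * s + 2)) * n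
  collect = solve-∀

module _ {r m n N : ℕ} (1≤n : 1 ≤ n) (m≤ : m ≤ n C (2 + r)) where

  -- The alternatives are the two terms of the maximum, the second raised to the power k - 1 and
  -- cleared of denominators. If t = 0, one colour suffices and no main factor arises; otherwise t +
  -- 1 ≤ 2t, and n t^(k-1) ≤ m turns tⁿ into the main factor.
  upper-bound : (∀ t → m ≤ n * suc t ^ suc r → N ≤ 2 * (suc t ^ n * 2 ^ codeLength r n (suc t) (2 * n))) →
                N ≤ 2 ^ (upperRate r * n) ⊎ N ^ suc r * n ^ n ≤ (2 ^ (upperRate r * n)) ^ suc r * m ^ n
  upper-bound count-upper with scale r m 1≤n m≤
  ... | zero , _ , m< , t≤n = inj₁ (begin
    N                        ≤⟨ count-upper 0 (<⇒≤ m<) ⟩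
    2 * (1 ^ n * 2 ^ Λ)      ≤⟨ *-monoʳ-≤ 2 (*-monoˡ-≤ (2 ^ Λ) (^-monoˡ-≤ n (s≤s z≤n))) ⟩
    2 * (2 ^ n * 2 ^ Λ)      ≤⟨ 2^1+n+code≤ r n 0 1≤n t≤n ⟩
    2 ^ (upperRate r * n) ∎)
    where
    open ≤-Reasoning
    Λ = codeLength r n 1 (2 * n)
  ... | t@(suc t′) , ≤m , m< , t≤n = inj₂ (begin
    N ^ suc r * n ^ n                     ≤⟨ *-monoˡ-≤ (n ^ n) (^-monoˡ-≤ (suc r) N≤) ⟩
    (E * t ^ n) ^ suc r * n ^ n           ≡⟨ cong (_* n ^ n) (^-distribʳ-* E (t ^ n) (suc r)) ⟩
    E ^ suc r * (t ^ n) ^ suc r * n ^ n   ≡⟨ cong (λ z → E ^ suc r * z * n ^ n) (^-swap t n (suc r)) ⟩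
    E ^ suc r * (t ^ suc r) ^ n * n ^ n   ≡⟨ trans (*-assoc (E ^ suc r) _ _) (cong (E ^ suc r *_) (trans (*-comm _ (n ^ n)) (sym (^-distribʳ-* n (t ^ suc r) n)))) ⟩
    E ^ suc r * (n * t ^ suc r) ^ n       ≤⟨ *-monoʳ-≤ (E ^ suc r) (^-monoˡ-≤ n ≤m) ⟩
    E ^ suc r * m ^ n ∎)
    where
    open ≤-Reasoning
    Λ = codeLength r n (suc t) (2 * n)
    E = 2 ^ (upperRate r * n)
    rearrange : ∀ a b c → 2 * (a * b * c) ≡ 2 * (a * c) * b
    rearrange = solve-∀
    N≤ : N ≤ E * t ^ n
    N≤ = begin
      N                            ≤⟨ count-upper t (<⇒≤ m<) ⟩
      2 * (suc t ^ n * 2 ^ Λ)      ≤⟨ *-monoʳ-≤ 2 (*-monoˡ-≤ (2 ^ Λ) (^-monoˡ-≤ n (+-mono-≤ {1} {t} (s≤s z≤n) (≤-reflexive (sym (+-identityʳ t)))))) ⟩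
      2 * ((2 * t) ^ n * 2 ^ Λ)    ≡⟨ cong (λ z → 2 * (z * 2 ^ Λ)) (^-distribʳ-* 2 t n) ⟩
      2 * (2 ^ n * t ^ n * 2 ^ Λ)  ≡⟨ rearrange (2 ^ n) (t ^ n) (2 ^ Λ) ⟩
      2 * (2 ^ n * 2 ^ Λ) * t ^ n  ≤⟨ *-monoˡ-≤ (t ^ n) (2^1+n+code≤ r n t 1≤n t≤n) ⟩
      E * t ^ n ∎

  -- Both terms of the maximum have to be bounded, hence the pair. The exponent 4n arises from t + 1
  -- + 2n with t ≤ n and 1 ≤ n.
  lower-bound : (∀ t → n * t ^ suc r ≤ m → suc t ^ n ≤ 2 ^ (suc t + 2 * n) * N) →
                1 ≤ N × m ^ n ≤ n ^ n * (2 ^ (4 * n) * N) ^ suc r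
  lower-bound count-lower with t , ≤m , m< , t≤n ← scale r m 1≤n m≤ = N≥1 , (begin
    m ^ n                                    ≤⟨ ^-monoˡ-≤ n (<⇒≤ m<) ⟩
    (n * suc t ^ suc r) ^ n                  ≡⟨ ^-distribʳ-* n (suc t ^ suc r) n ⟩
    n ^ n * (suc t ^ suc r) ^ n              ≡⟨ cong (n ^ n *_) (^-swap (suc t) (suc r) n) ⟩
    n ^ n * (suc t ^ n) ^ suc r              ≤⟨ *-monoʳ-≤ (n ^ n) (^-monoˡ-≤ (suc r) (bound t ≤m t≤n)) ⟩
    n ^ n * (2 ^ (4 * n) * N) ^ suc r ∎)
    where
    open ≤-Reasoning
    bound : ∀ t → n * t ^ suc r ≤ m → t ≤ n → suc t ^ n ≤ 2 ^ (4 * n) * N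
    bound t ≤m t≤n = ≤-trans (count-lower t ≤m) (*-monoˡ-≤ N (^-monoʳ-≤ 2 (≤-trans
      (+-monoˡ-≤ (2 * n) (+-mono-≤ 1≤n t≤n)) (≤-reflexive (four n)))))
      where
      four : ∀ n → n + n + 2 * n ≡ 4 * n
      four = solve-∀
    N≥1 : 1 ≤ N
    N≥1 = n≢0⇒n>0 λ N≡0 → <⇒≱ (m^n>0 (suc t) n) (subst (suc t ^ n ≤_) (trans (cong (2 ^ (suc t + 2 * n) *_) N≡0) (*-zeroʳ (2 ^ (suc t + 2 * n)))) (count-lower t ≤m))

module _ {r m : ℕ} (π : Permutation′ (2 + r)) where

  count-upper : ∀ n t → m ≤ n * suc t ^ suc r → #permutationsWithAtMost m π n ≤ 2 * (suc t ^ n * 2 ^ codeLength r n (suc t) (2 * n))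
  count-upper n t m≤′ = count-few-copies π m (suc t) (s≤s z≤n) m≤′
    (AllPairs.filter⁺ (λ σ → #copies π σ ≤? m) (permutations-unique n)) (All.all-filter (λ σ → #copies π σ ≤? m) (permutations n))

  count-lower : ∀ n t → n * t ^ suc r ≤ m → suc t ^ n ≤ 2 ^ (suc t + 2 * n) * #permutationsWithAtMost m π n
  count-lower n t ≤m = blocks (n ℕ.% suc t) (n ℕ./ suc t) (m≡m%n+[m/n]*n n (suc t)) (<⇒≤ (m%n<n n (suc t))) ≤m
    where
    blocks : ∀ {n} u q → n ≡ u + q * suc t → u ≤ suc t → n * t ^ suc r ≤ m →
             suc t ^ n ≤ 2 ^ (suc t + 2 * n) * #permutationsWithAtMost m π n
    blocks u q refl u≤ ≤m = ≤-trans (power-≤-blockwise (suc t) q u)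
      (*-monoʳ-≤ (2 ^ (suc t + 2 * (u + q * suc t))) (blockwise-≤-count t q u π u≤ ≤m))

  upper-ℕ : ∀ {n} → 1 ≤ n → m ≤ n C (2 + r) → let N = #permutationsWithAtMost m π n in
            N ≤ 2 ^ (upperRate r * n) ⊎ N ^ suc r * n ^ n ≤ (2 ^ (upperRate r * n)) ^ suc r * m ^ n
  upper-ℕ {n} 1≤n m≤ = upper-bound 1≤n m≤ (count-upper n)

  lower-ℕ : ∀ {n} → 1 ≤ n → m ≤ n C (2 + r) → let N = #permutationsWithAtMost m π n in
            1 ≤ N × m ^ n ≤ n ^ n * (2 ^ (4 * n) * N) ^ suc r
  lower-ℕ {n} 1≤n m≤ = lower-bound 1≤n m≤ (count-lower n)

open import Data.Integer.Base using (ℤ; +_; -[1+_])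

-- Fractions of natural numbers

module _ {a b c d : ℕ} .{{_ : NonZero b}} .{{_ : NonZero d}} where
  private
    pos : ∀ x y → (+ x) ℤ.* (+ y) ≡ + (x * y)
    pos x y = sym (ℤ.pos-* x y)

  /-<⁺ : a * d < c * b → + a / b ℚ.< + c / d
  /-<⁺ = lemma b d
    where
    lemma : ∀ b d .{{_ : NonZero b}} .{{_ : NonZero d}} → a * d < c * b → + a / b ℚ.< + c / d
    lemma (suc b) (suc d) h = *<* (subst₂ ℤ._<_ (ℤ.pos-* a (suc d)) (ℤ.pos-* c (suc b)) (ℤ.+<+ h))

  /-<⁻ : + a / b ℚ.< + c / d → a * d < c * b
  /-<⁻ = lemma b d
    where
    lemma : ∀ b d .{{_ : NonZero b}} .{{_ : NonZero d}} → + a / b ℚ.< + c / d → a * d < c * b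
    lemma (suc b) (suc d) h = ℤ.drop‿+<+ (subst₂ ℤ._<_ (pos a (suc d)) (pos c (suc b)) (ℚ.drop-*<* h))

  /-≤⁺ : a * d ≤ c * b → + a / b ℚ.≤ + c / d
  /-≤⁺ = lemma b d
    where
    lemma : ∀ b d .{{_ : NonZero b}} .{{_ : NonZero d}} → a * d ≤ c * b → + a / b ℚ.≤ + c / d
    lemma (suc b) (suc d) h = *≤* (subst₂ ℤ._≤_ (ℤ.pos-* a (suc d)) (ℤ.pos-* c (suc b)) (ℤ.+≤+ h))

  /-* : (+ a / b) ℚ.* (+ c / d) ℚ.≃ _/_ (+ (a * c)) (b * d) {{m*n≢0 b d}}
  /-* = lemma b d
    where
    lemma : ∀ b d .{{_ : NonZero b}} .{{_ : NonZero d}} → (+ a / b) ℚ.* (+ c / d) ℚ.≃ _/_ (+ (a * c)) (b * d) {{m*n≢0 b d}}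
    lemma (suc b) (suc d) = *≡* (cong (ℤ._* + (suc b * suc d)) (pos a c))

^ℕ-cong : ∀ {x y} n → x ℚ.≃ y → x ^ℕ n ℚ.≃ y ^ℕ n
^ℕ-cong zero    x≃y = ℚ.≃-refl
^ℕ-cong (suc n) x≃y = ℚ.*-cong x≃y (^ℕ-cong n x≃y)

/-^ : ∀ a b .{{_ : NonZero b}} n → (+ a / b) ^ℕ n ℚ.≃ _/_ (+ (a ^ n)) (b ^ n) {{m^n≢0 b n}}
/-^ a b zero    = ℚ.≃-refl
/-^ a b (suc n) = ℚ.≃-trans (ℚ.*-cong (ℚ.≃-refl {+ a / b}) (/-^ a b n)) (/-* {a} {b} {a ^ n} {b ^ n} {{_}} {{m^n≢0 b n}})

0≤⇒fraction : ∀ {q} → 0ℚᵘ ℚ.≤ q → ∃[ a ] ∃[ b ] q ≡ + a / suc b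
0≤⇒fraction {mkℚᵘ (+ a) b} _ = a , b , refl
0≤⇒fraction {mkℚᵘ -[1+ a ] b} (*≤* ())

-- Bounds for the exponential

-- Bernoulli's inequality for 1 + x/J, multiplied by J^(a+1).
weak-bernoulli : ∀ x J a → J ^ a * (J + a * x) ≤ J * (J + x) ^ a
weak-bernoulli x J zero    = ≤-reflexive (trans (*-identityˡ _) (trans (+-identityʳ J) (sym (*-identityʳ J))))
weak-bernoulli x J (suc a) = begin
  J * P * (J + suc a * x)               ≤⟨ m≤m+n _ (P * (a * x * x)) ⟩
  J * P * (J + suc a * x) + P * (a * x * x) ≡⟨ expand J P a x ⟩
  (J + x) * (P * (J + a * x))         ≤⟨ *-monoʳ-≤ (J + x) (weak-bernoulli x J a) ⟩
  (J + x) * (J * (J + x) ^ a)         ≡⟨ rearrange (J + x) J ((J + x) ^ a) ⟩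
  J * ((J + x) * (J + x) ^ a) ∎
  where
  open ≤-Reasoning
  P = J ^ a
  expand : ∀ J P a x → J * P * (J + suc a * x) + P * (a * x * x) ≡ (J + x) * (P * (J + a * x))
  expand = solve-∀
  rearrange : ∀ a b c → a * (b * c) ≡ b * (a * c)
  rearrange = solve-∀

-- With a = ⌊J/x⌋ + 1 steps the power (1 + x/J)ᵃ reaches 2, and y such
-- stretches fit into J steps.
2^y≤[1+2y/J]^J : ∀ y J .{{_ : NonZero J}} → 2 * y ≤ J → 2 ^ y * J ^ J ≤ (J + 2 * y) ^ J
2^y≤[1+2y/J]^J zero     J _   = ≤-reflexive (trans (*-identityˡ _) (cong (_^ J) (sym (+-identityʳ J))))
2^y≤[1+2y/J]^J y@(suc y′) J x≤J = begin
  2 ^ y * J ^ J                                     ≡⟨ cong (λ e → 2 ^ y * J ^ e) (sym (m+[n∸m]≡n ay≤J)) ⟩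
  2 ^ y * J ^ (a * y + d)                       ≡⟨ cong (2 ^ y *_) (trans (^-distribˡ-+-* J (a * y) d) (cong (_* J ^ d) (sym (^-*-assoc J a y)))) ⟩
  2 ^ y * ((J ^ a) ^ y * J ^ d)               ≡⟨ trans (sym (*-assoc (2 ^ y) _ _)) (cong (_* J ^ d) (sym (^-distribʳ-* 2 (J ^ a) y))) ⟩
  (2 * J ^ a) ^ y * J ^ d                       ≤⟨ *-mono-≤ (^-monoˡ-≤ y doubles) (^-monoˡ-≤ d (m≤m+n J x)) ⟩
  ((J + x) ^ a) ^ y * (J + x) ^ d             ≡⟨ cong (_* (J + x) ^ d) (^-*-assoc (J + x) a y) ⟩
  (J + x) ^ (a * y) * (J + x) ^ d             ≡⟨ sym (^-distribˡ-+-* (J + x) (a * y) d) ⟩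
  (J + x) ^ (a * y + d)                           ≡⟨ cong ((J + x) ^_) (m+[n∸m]≡n ay≤J) ⟩
  (J + x) ^ J ∎
  where
  open ≤-Reasoning
  x = 2 * y
  a = suc (J ℕ./ x)
  d = J ∸ a * y
  J≤ax : J ≤ a * x
  J≤ax = ≤-trans (≤-reflexive (m≡m%n+[m/n]*n J x)) (+-monoˡ-≤ (J ℕ./ x * x) (<⇒≤ (m%n<n J x)))
  ay≤J : a * y ≤ J
  ay≤J = *-cancelˡ-≤ 2 (begin
    2 * (a * y)          ≡⟨ swap a y ⟩
    x + J ℕ./ x * x      ≤⟨ +-mono-≤ x≤J (≤-trans (m≤n+m _ (J ℕ.% x)) (≤-reflexive (sym (m≡m%n+[m/n]*n J x)))) ⟩
    J + J                  ≡⟨ cong (λ z → J + z) (sym (+-identityʳ J)) ⟩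
    2 * J ∎)
    where
    swap : ∀ a y → 2 * (a * y) ≡ a * (2 * y)
    swap = solve-∀
  doubles : 2 * J ^ a ≤ (J + x) ^ a
  doubles = *-cancelˡ-≤ J (begin
    J * (2 * J ^ a)          ≡⟨ twice J (J ^ a) ⟩
    J ^ a * (J + J)          ≤⟨ *-monoʳ-≤ (J ^ a) (+-monoʳ-≤ J J≤ax) ⟩
    J ^ a * (J + a * x)    ≤⟨ weak-bernoulli x J a ⟩
    J * (J + x) ^ a ∎)
    where
    twice : ∀ J p → J * (2 * p) ≡ p * (J + J)
    twice = solve-∀

-- Follows from the bound for 1 + 2y/J, because (1 - z)(1 + z) ≤ 1.
2^y*[1-2y/J]^J≤1 : ∀ y J .{{_ : NonZero J}} → 2 * y ≤ J → (J ∸ 2 * y) ^ J * 2 ^ y ≤ J ^ J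
2^y*[1-2y/J]^J≤1 y J x≤J = *-cancelʳ-≤ _ _ (J ^ J) {{m^n≢0 J J}} (begin
  (J ∸ x) ^ J * 2 ^ y * J ^ J     ≡⟨ *-assoc ((J ∸ x) ^ J) _ _ ⟩
  (J ∸ x) ^ J * (2 ^ y * J ^ J)   ≤⟨ *-monoʳ-≤ ((J ∸ x) ^ J) (2^y≤[1+2y/J]^J y J x≤J) ⟩
  (J ∸ x) ^ J * (J + x) ^ J         ≡⟨ sym (^-distribʳ-* (J ∸ x) (J + x) J) ⟩
  ((J ∸ x) * (J + x)) ^ J             ≤⟨ ^-monoˡ-≤ J difference ⟩
  (J * J) ^ J                             ≡⟨ ^-distribʳ-* J J J ⟩
  J ^ J * J ^ J ∎)
  where
  open ≤-Reasoning
  x = 2 * y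
  difference : (J ∸ x) * (J + x) ≤ J * J
  difference = begin
    (J ∸ x) * (J + x)                 ≡⟨ *-distribˡ-+ (J ∸ x) J x ⟩
    (J ∸ x) * J + (J ∸ x) * x     ≤⟨ +-monoʳ-≤ ((J ∸ x) * J) (≤-trans (*-monoˡ-≤ x (m∸n≤m J x)) (≤-reflexive (*-comm J x))) ⟩
    (J ∸ x) * J + x * J             ≡⟨ sym (*-distribʳ-+ J (J ∸ x) x) ⟩
    (J ∸ x + x) * J                   ≡⟨ cong (_* J) (m∸n+n≡m x≤J) ⟩
    J * J ∎

exp-base : ∀ c n j → 1ℚᵘ ℚ.+ c / 1 ℚ.* (+ n / 1) ℚ.* (+ 1 / suc j) ℚ.≃ (+ suc j ℤ.+ c ℤ.* + n) / suc j
exp-base c n j = *≡* (begin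
  (ℤ.1ℤ ℤ.* + (1 * suc j) ℤ.+ c ℤ.* + n ℤ.* ℤ.1ℤ ℤ.* ℤ.1ℤ) ℤ.* + suc j
    ≡⟨ cong (ℤ._* + suc j) (numerator (+ (1 * suc j)) c (+ n)) ⟩
  (+ (1 * suc j) ℤ.+ c ℤ.* + n) ℤ.* + suc j
    ≡⟨ cong₂ (λ J J′ → (+ J ℤ.+ c ℤ.* + n) ℤ.* + J′) (*-identityˡ (suc j)) (sym (trans (*-identityˡ _) (*-identityˡ _))) ⟩
  (+ suc j ℤ.+ c ℤ.* + n) ℤ.* + (1 * (1 * suc j)) ∎)
  where
  open ≡-Reasoning
  numerator : ∀ J c n → ℤ.1ℤ ℤ.* J ℤ.+ c ℤ.* n ℤ.* ℤ.1ℤ ℤ.* ℤ.1ℤ ≡ J ℤ.+ c ℤ.* n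
  numerator = ℤ-solve-∀

exp-term : ∀ c n j a → + suc j ℤ.+ c ℤ.* + n ≡ + a →
           (1ℚᵘ ℚ.+ c / 1 ℚ.* (+ n / 1) ℚ.* (+ 1 / suc j)) ^ℕ suc j ℚ.≃ _/_ (+ (a ^ suc j)) (suc j ^ suc j) {{m^n≢0 (suc j) (suc j)}}
exp-term c n j a eq = ℚ.≃-trans (^ℕ-cong (suc j) (ℚ.≃-trans (exp-base c n j) (ℚ.≃-reflexive (cong (_/ suc j) eq)))) (/-^ a (suc j) (suc j))

-- All terms from index 2y on are at least 2^y, so 2^y itself can be the intermediate rational in
-- `lim`. The factor 2 in the exponent is that of `2^y≤[1+2y/J]^J`.
exp-≥ : ∀ γ n {q} → q ℚ.< + (2 ^ (γ * n)) / 1 → exp (+ (2 * γ) / 1 ℚ.* (+ n / 1)) q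
exp-≥ γ n q< = + (2 ^ y) / 1 , q< , 2 * y , λ j x≤j →
  ℚ.≤-respʳ-≃ (ℚ.≃-sym (exp-term (+ (2 * γ)) n j (suc j + 2 * y)
      (trans (cong (λ z → + suc j ℤ.+ z) (trans (sym (ℤ.pos-* (2 * γ) n)) (cong +_ (*-assoc 2 γ n)))) (sym (ℤ.pos-+ (suc j) (2 * y))))))
    (/-≤⁺ {{_}} {{m^n≢0 (suc j) (suc j)}} (≤-trans (2^y≤[1+2y/J]^J y (suc j) (m≤n⇒m≤1+n x≤j)) (≤-reflexive (sym (*-identityʳ _)))))
  where y = γ * n

exp-< : ∀ γ n {a b} → exp ((ℤ.- + (2 * γ)) / 1 ℚ.* (+ n / 1)) (+ a / suc b) → a * 2 ^ (γ * n) < suc b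
exp-< γ n {a} {b} (q′ , q<q′ , j₀ , below) = *-cancelʳ-< _ _ _ (begin-strict
  a * 2 ^ y * J ^ J                      ≡⟨ rearrange a (2 ^ y) (J ^ J) ⟩
  a * J ^ J * 2 ^ y                      <⟨ *-monoˡ-< (2 ^ y) {{m^n≢0 2 y}} below-term ⟩
  (J ∸ 2 * y) ^ J * suc b * 2 ^ y    ≡⟨ rearrange ((J ∸ 2 * y) ^ J) (suc b) (2 ^ y) ⟩
  (J ∸ 2 * y) ^ J * 2 ^ y * suc b    ≤⟨ *-monoˡ-≤ (suc b) (2^y*[1-2y/J]^J≤1 y J x≤J) ⟩
  J ^ J * suc b                              ≡⟨ *-comm (J ^ J) (suc b) ⟩
  suc b * J ^ J ∎)
  where
  open ≤-Reasoning
  y = γ * n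
  -- Beyond `j₀` the terms of the sequence are bounded below, and beyond 2y the base 1 - 2y/J is
  -- nonnegative, so that truncated subtraction is exact.
  j = 2 * y ⊔ j₀
  J = suc j
  x≤J : 2 * y ≤ J
  x≤J = m≤n⇒m≤1+n (m≤m⊔n _ _)
  rearrange : ∀ a b c → a * b * c ≡ a * c * b
  rearrange = solve-∀
  subtract : + J ℤ.+ (ℤ.- + (2 * γ)) ℤ.* + n ≡ + (J ∸ 2 * y)
  subtract = trans (cong (λ z → + J ℤ.+ z) (trans (sym (ℤ.neg-distribˡ-* (+ (2 * γ)) (+ n)))
      (cong ℤ.-_ (trans (sym (ℤ.pos-* (2 * γ) n)) (cong +_ (*-assoc 2 γ n))))))
    (trans (ℤ.m-n≡m⊖n J (2 * y)) (ℤ.⊖-≥ x≤J))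
  below-term : a * J ^ J < (J ∸ 2 * y) ^ J * suc b
  below-term = /-<⁻ {{_}} {{m^n≢0 J J}} (ℚ.<-≤-trans q<q′
    (ℚ.≤-respʳ-≃ (exp-term (ℤ.- + (2 * γ)) n j (J ∸ 2 * y) subtract) (below j (m≤n⊔m _ _))))

-- The bounds as inequalities between cuts

Below : (m n r : ℕ) → ℚᵘ → Set
Below m n r = max (fromℕ 1) ((m /₀ n) ^[ n / r ])

-- Bounding the maximum by `T` takes one hypothesis per term. For n = 0 the power has exponent 0 and
-- equals 1, so `1 ≤ T` handles it and the second hypothesis may assume 1 ≤ n.
Below-≤ : ∀ {a b m n r T} → 1 ≤ T → (1 ≤ n → m ^ n ≤ n ^ n * T ^ suc r) → Below m n (suc r) (+ a / suc b) → a ≤ T * suc b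
Below-≤ {a} {b} {T = T} 1≤T h (inj₁ a/b<1) = begin
  a              ≡⟨ sym (*-identityʳ a) ⟩
  a * 1        ≤⟨ <⇒≤ (/-<⁻ a/b<1) ⟩
  1 * suc b    ≤⟨ *-monoˡ-≤ (suc b) 1≤T ⟩
  T * suc b ∎
  where open ≤-Reasoning
Below-≤ 1≤T h (inj₂ (inj₁ a/b<0)) = contradiction (/-<⁻ a/b<0) λ ()
Below-≤ {a} {b} {m} {zero} {r} {T} 1≤T h (inj₂ (inj₂ a/b^r<1)) = ^-cancelʳ-≤ r (begin
  a ^ suc r                      ≡⟨ sym (*-identityʳ _) ⟩
  a ^ suc r * 1                ≤⟨ <⇒≤ (/-<⁻ {{m^n≢0 (suc b) (suc r)}} (ℚ.<-respˡ-≃ (/-^ a (suc b) (suc r)) a/b^r<1)) ⟩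
  1 * suc b ^ suc r            ≡⟨ *-identityˡ _ ⟩
  suc b ^ suc r                  ≤⟨ ^-monoˡ-≤ (suc r) (m≤n*m (suc b) T {{>-nonZero 1≤T}}) ⟩
  (T * suc b) ^ suc r ∎)
  where open ≤-Reasoning
Below-≤ {a} {b} {m} {n@(suc _)} {r} {T} 1≤T h (inj₂ (inj₂ a/b^r<m/n^n)) = ^-cancelʳ-≤ r (*-cancelʳ-≤ _ _ (n ^ n) {{m^n≢0 n n}} (begin
  a ^ suc r * n ^ n
    ≤⟨ <⇒≤ (/-<⁻ {{m^n≢0 (suc b) (suc r)}} {{m^n≢0 n n}} (ℚ.<-respˡ-≃ (/-^ a (suc b) (suc r)) (ℚ.<-respʳ-≃ (/-^ m n n) a/b^r<m/n^n))) ⟩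
  m ^ n * suc b ^ suc r                        ≤⟨ *-monoˡ-≤ (suc b ^ suc r) (h (s≤s z≤n)) ⟩
  n ^ n * T ^ suc r * suc b ^ suc r        ≡⟨ rearrange (n ^ n) (T ^ suc r) (suc b ^ suc r) ⟩
  T ^ suc r * suc b ^ suc r * n ^ n        ≡⟨ cong (_* n ^ n) (sym (^-distribʳ-* T (suc b) (suc r))) ⟩
  (T * suc b) ^ suc r * n ^ n ∎))
  where
  open ≤-Reasoning
  rearrange : ∀ a b c → a * b * c ≡ b * c * a
  rearrange = solve-∀

-- For n = 0 both factors equal 1, and there is no slack in the exponential: a rational below 1 must
-- be bounded by a product of two rationals that are themselves strictly below 1.
≼-upper-zero : ∀ γ {m r} → fromℕ 1 ≼ exp (+ (2 * γ) / 1 ℚ.* (+ 0 / 1)) · Below m 0 r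
≼-upper-zero γ (mkℚᵘ -[1+ p ] d) q<1 = inj₁ (*<* ℤ.-<+)
≼-upper-zero γ (mkℚᵘ (+ p) d) q<1 = inj₂ (root , root , /-≤⁺ z≤n , exp-≥ γ 0 root<1′ , /-≤⁺ z≤n , inj₁ root<1 ,
  ℚ.≤-respʳ-≃ (ℚ.≃-sym (/-* {suc (2 * p)} {2 * suc p} {suc (2 * p)} {2 * suc p}))
    (/-≤⁺ {{_}} {{m*n≢0 (2 * suc p) (2 * suc p)}} square))
  where
  open ≤-Reasoning
  -- The square of (2p+1)/(2p+2) exceeds p/(p+1).
  root : ℚᵘ
  root = + suc (2 * p) / (2 * suc p)
  root<1 : root ℚ.< + 1 / 1
  root<1 = /-<⁺ (≤-reflexive (base p))
    where
    base : ∀ p → suc (suc (2 * p) * 1) ≡ 1 * (2 * suc p)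
    base = solve-∀
  root<1′ : root ℚ.< + (2 ^ (γ * 0)) / 1
  root<1′ = subst (λ e → root ℚ.< + (2 ^ e) / 1) (sym (*-zeroʳ γ)) root<1
  p<d : p < suc d
  p<d = subst₂ _<_ (*-identityʳ p) (*-identityˡ (suc d)) (/-<⁻ {p} {suc d} {1} {1} q<1)
  square : p * (2 * suc p * (2 * suc p)) ≤ suc (2 * p) * suc (2 * p) * suc d
  square = begin
    p * (2 * suc p * (2 * suc p))            ≤⟨ m≤m+n _ (suc p) ⟩
    p * (2 * suc p * (2 * suc p)) + suc p  ≡⟨ expand p ⟩
    suc (2 * p) * suc (2 * p) * suc p        ≤⟨ *-monoʳ-≤ (suc (2 * p) * suc (2 * p)) p<d ⟩
    suc (2 * p) * suc (2 * p) * suc d ∎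
    where
    expand : ∀ p → p * (2 * suc p * (2 * suc p)) + suc p ≡ suc (2 * p) * suc (2 * p) * suc p
    expand = solve-∀

-- A rational q below N is split as E · (q/E). The factor E must lie strictly below the exponential,
-- so the rate is doubled once more, in addition to the doubling in `exp-≥`; `suc β` and `suc n`
-- keep the exponent positive, which makes the gap strict.
≼-upper : ∀ β {m n r N} → N ≤ 2 ^ (suc β * suc n) ⊎ N ^ suc r * suc n ^ suc n ≤ (2 ^ (suc β * suc n)) ^ suc r * m ^ suc n →
          fromℕ N ≼ exp (+ (2 * (2 * suc β)) / 1 ℚ.* (+ suc n / 1)) · Below m (suc n) (suc r)
≼-upper β bound (mkℚᵘ -[1+ p ] d) q<N = inj₁ (*<* ℤ.-<+)
≼-upper β {m} {n} {r} {N} bound (mkℚᵘ (+ p) d) q<N = inj₂ (+ E / 1 , t , /-≤⁺ z≤n ,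
  exp-≥ (2 * suc β) (suc n) (/-<⁺ (*-monoˡ-< 1 E<)) , /-≤⁺ {{_}} {{dE≢0}} z≤n , below bound ,
  ℚ.≤-respʳ-≃ (ℚ.≃-sym (/-* {E} {1} {p} {suc d * E} {{_}} {{dE≢0}}))
    (/-≤⁺ {{_}} {{m*n≢0 1 (suc d * E) {{_}} {{dE≢0}}}} (≤-reflexive (cancel p (suc d) E))))
  where
  open ≤-Reasoning
  E = 2 ^ (suc β * suc n)
  instance
    E≢0 : NonZero E
    E≢0 = m^n≢0 2 (suc β * suc n)
  dE≢0 : NonZero (suc d * E)
  dE≢0 = m*n≢0 (suc d) E
  t : ℚᵘ
  t = _/_ (+ p) (suc d * E) {{dE≢0}}
  cancel : ∀ p d E → p * (1 * (d * E)) ≡ E * p * d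
  cancel = solve-∀
  E< : E < 2 ^ (2 * suc β * suc n)
  E< = ^-monoʳ-< 2 (s≤s (s≤s z≤n)) (*-monoˡ-< (suc n) (m<m+n (suc β) (s≤s z≤n)))
  p<Nd : p < N * suc d
  p<Nd = subst (_< N * suc d) (*-identityʳ p) (/-<⁻ {p} {suc d} {N} {1} q<N)
  below : N ≤ E ⊎ N ^ suc r * suc n ^ suc n ≤ E ^ suc r * m ^ suc n → Below m (suc n) (suc r) t
  below (inj₁ N≤E) = inj₁ (/-<⁺ {{dE≢0}} (begin-strict
    p * 1                ≡⟨ *-identityʳ p ⟩
    p                      <⟨ p<Nd ⟩
    N * suc d            ≤⟨ *-monoˡ-≤ (suc d) N≤E ⟩
    E * suc d            ≡⟨ trans (*-comm E (suc d)) (sym (*-identityˡ _)) ⟩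
    1 * (suc d * E) ∎))
  below (inj₂ N^r≤) = inj₂ (inj₂ (ℚ.<-respˡ-≃ (ℚ.≃-sym (/-^ p (suc d * E) {{dE≢0}} (suc r))) (ℚ.<-respʳ-≃ (ℚ.≃-sym (/-^ m (suc n) (suc n)))
    (/-<⁺ {{m^n≢0 (suc d * E) (suc r) {{dE≢0}}}} {{m^n≢0 (suc n) (suc n)}} (begin-strict
      p ^ suc r * suc n ^ suc n               <⟨ *-monoˡ-< (suc n ^ suc n) {{m^n≢0 (suc n) (suc n)}} (^-monoˡ-< (suc r) p<Nd) ⟩
      (N * suc d) ^ suc r * suc n ^ suc n   ≡⟨ cong (_* suc n ^ suc n) (^-distribʳ-* N (suc d) (suc r)) ⟩
      N ^ suc r * suc d ^ suc r * suc n ^ suc n ≡⟨ swap (N ^ suc r) (suc d ^ suc r) (suc n ^ suc n) ⟩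
      N ^ suc r * suc n ^ suc n * suc d ^ suc r ≤⟨ *-monoˡ-≤ (suc d ^ suc r) N^r≤ ⟩
      E ^ suc r * m ^ suc n * suc d ^ suc r     ≡⟨ rotate (E ^ suc r) (m ^ suc n) (suc d ^ suc r) ⟩
      m ^ suc n * (suc d ^ suc r * E ^ suc r)   ≡⟨ cong (m ^ suc n *_) (sym (^-distribʳ-* (suc d) E (suc r))) ⟩
      m ^ suc n * (suc d * E) ^ suc r ∎)))))
    where
    swap : ∀ a b c → a * b * c ≡ a * c * b
    swap = solve-∀
    rotate : ∀ a b c → a * b * c ≡ b * (c * a)
    rotate = solve-∀

-- The maximum is at most 2^(γ n) N by `Below-≤`, and by `exp-<` the exponential cancels the power
-- of 2.
≼-lower : ∀ γ {m n r N} → 1 ≤ N → (1 ≤ n → m ^ n ≤ n ^ n * (2 ^ (γ * n) * N) ^ suc r) →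
          exp ((ℤ.- + (2 * γ)) / 1 ℚ.* (+ n / 1)) · Below m n (suc r) ≼ fromℕ N
≼-lower γ {m} {n} {r} {N} 1≤N h q (inj₁ q<0) = ℚ.<-trans q<0 (/-<⁺ (*-monoˡ-< 1 1≤N))
≼-lower γ {m} {n} {r} {N} 1≤N h q (inj₂ (s , t , 0≤s , s< , 0≤t , t< , q≤st)) with 0≤⇒fraction 0≤s | 0≤⇒fraction 0≤t
... | a , b , refl | c , d , refl = ℚ.≤-<-trans q≤st (ℚ.<-respˡ-≃ (ℚ.≃-sym (/-* {a} {suc b} {c} {suc d})) (/-<⁺ {{m*n≢0 (suc b) (suc d)}} (begin-strict
  a * c * 1                             ≡⟨ *-identityʳ _ ⟩
  a * c                                   ≤⟨ *-monoʳ-≤ a (Below-≤ {c} {d} {m} {n} {r} (*-mono-≤ {1} {B} {1} {N} (m^n>0 2 (γ * n)) 1≤N) h t<) ⟩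
  a * (B * N * suc d)                 ≡⟨ regroup a B N (suc d) ⟩
  a * B * (N * suc d)                 <⟨ *-monoˡ-< (N * suc d) {{m*n≢0 N (suc d) {{>-nonZero 1≤N}}}} (exp-< γ n {a} {b} s<) ⟩
  suc b * (N * suc d)                   ≡⟨ exchange (suc b) N (suc d) ⟩
  N * (suc b * suc d) ∎)))
  where
  open ≤-Reasoning
  B = 2 ^ (γ * n)
  regroup : ∀ a b c d → a * (b * c * d) ≡ a * b * (c * d)
  regroup = solve-∀
  exchange : ∀ a b c → a * (b * c) ≡ b * (a * c)
  exchange = solve-∀

upper : ∀ {r} (π : Permutation′ (2 + r)) m n → m ≤ n C (2 + r) →
        fromℕ (#permutationsWithAtMost m π n) ≼ exp (+ (2 * (2 * upperRate r)) / 1 ℚ.* (+ n / 1)) · Below m n (suc r)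
upper {r} π m zero    m≤ = ≼-upper-zero (2 * upperRate r) {m} {suc r}
-- `upperRate r` is a successor by definition, so its predecessor plays the part of `β`.
upper {r} π m (suc n) m≤ = ≼-upper (pred (upperRate r)) {m} {n} {r} (upper-ℕ π {suc n} (s≤s z≤n) m≤)

-- Here 8 = 2 · 4: the loss 2^(4n) of `lower-bound`, and the factor 2 between powers of 2 and `exp`.
lower : ∀ {r} (π : Permutation′ (2 + r)) m n → m ≤ n C (2 + r) →
        exp ((ℤ.- + 8) / 1 ℚ.* (+ n / 1)) · Below m n (suc r) ≼ fromℕ (#permutationsWithAtMost m π n)
-- For n = 0 there are no tuples of indices, so the only permutation has no copies and the count
-- computes to 1.
lower {r} π m zero      m≤ = ≼-lower 4 {m} {0} {r} (s≤s z≤n) λ ()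
lower {r} π m n@(suc _) m≤ = ≼-lower 4 {m} {n} {r} (proj₁ (lower-ℕ π {n} (s≤s z≤n) m≤)) λ 1≤n → proj₂ (lower-ℕ π {n} 1≤n m≤)

theorem2p3 : (k : ℕ) → 1 < k → (π : Permutation′ k) →
    (Σ[ c ∈ ℚᵘ ] ((m n : ℕ) → m ≤ n C k →
    fromℕ (#permutationsWithAtMost m π n)
    ≼ exp (c ℚ.* (+ n / 1)) · max (fromℕ 1) ((m /₀ n) ^[ n / (k ∸ 1) ])))
    ×
    (Σ[ c′ ∈ ℚᵘ ] ((m n : ℕ) → m ≤ n C k →
    exp (c′ ℚ.* (+ n / 1)) · max (fromℕ 1) ((m /₀ n) ^[ n / (k ∸ 1) ])
    ≼ fromℕ (#permutationsWithAtMost m π n)))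
theorem2p3 (suc (suc r)) _ π = (+ (2 * (2 * upperRate r)) / 1 , upper π) , ((ℤ.- + 8) / 1 , lower π)
theorem2p3 (suc zero) (s≤s ())
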